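{- There are only finitely many positive integers $n$ for which $\overline{F}_n$ is an integer, and the largest such $n$ is $n=58$.
   Context: For a positive integer $n$, $\overline{F}_n=\Big(\prod_{1\le h\le k\le n,\ \gcd(h,k)=1}\frac{h}{k}\Big)^{ -1}$ is the reciprocal of the product of all nonzero Farey fractions of order $n$ (a positive rational number). -}

module Defs where

open import Data.Nat as ℕ using (ℕ; suc)
open import Data.Nat.GCD using (gcd)
open import Data.Integer as ℤ using (ℤ; +_)
open import Data.Rational using (ℚ; 1ℚ; _/_; _*_; 1/_; NonZero; Positive)
open import Data.Rational.Properties using (normalize-pos; pos*pos⇒pos; pos⇒nonZero)
open import Data.List using (List; []; _∷_; map; filter; foldr; upTo; cartesianProduct)
open import Data.Product using (_×_; _,_; ∃-syntax)
open import Relation.Binary.PropositionalEquality using (_≡_)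
open import Relation.Nullary.Decidable using (_×-dec_)

-- A pair (i , j) stands for h = suc i and k = suc j, so that h, k ≥ 1 holds
-- by construction and the denominator k is visibly non-zero.
toFraction : ℕ × ℕ → ℚ
toFraction (i , j) = + suc i / suc j

-- The (i , j) with 1 ≤ suc i ≤ suc j ≤ n and gcd (suc i) (suc j) = 1.
fareyIndices : ℕ → List (ℕ × ℕ)
fareyIndices n =
  filter (λ (i , j) → (suc i ℕ.≤? suc j) ×-dec (gcd (suc i) (suc j) ℕ.≟ 1))
         (cartesianProduct (upTo n) (upTo n))

productℚ : List ℚ → ℚ
productℚ = foldr _*_ 1ℚ

fareyProduct : ℕ → ℚ
fareyProduct n = productℚ (map toFraction (fareyIndices n))

productℚ-toFraction-pos : ∀ ps → Positive (productℚ (map toFraction ps))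
productℚ-toFraction-pos []             = _
productℚ-toFraction-pos ((i , j) ∷ ps) =
  pos*pos⇒pos (toFraction (i , j)) {{normalize-pos (suc i) (suc j)}}
              (productℚ (map toFraction ps)) {{productℚ-toFraction-pos ps}}

fareyProduct-nonZero : ∀ n → NonZero (fareyProduct n)
fareyProduct-nonZero n =
  pos⇒nonZero (fareyProduct n) {{productℚ-toFraction-pos (fareyIndices n)}}

F̄ : ℕ → ℚ
F̄ n = 1/_ (fareyProduct n) {{fareyProduct-nonZero n}}

IsInteger : ℚ → Set
IsInteger q = ∃[ z ] q ≡ z / 1

{-# OPTIONS --safe #-}
module Submission where

-- F̄ₙ is an integer iff the product N of the numerators of the Farey fractions divides
-- the product D of the denominators. If p is a prime with n/3 < p ≤ (3n+1)/8, write
-- n = 2p + r; then p occurs 2(p-1) times in D but p - 1 + r + ⌈r/2⌉ > 2(p-1) times in N,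
-- so N ∤ D. Such a prime exists for every n ≥ 99: below 10⁹ by an explicit list, above
-- because ψ(3n/8) > ψ(n/3) + ψ(√n). The latter needs ψ(x)/x up to a factor 9/8, which
-- follows from ψ-inequalities obtained, like Chebyshev's, from quotients of factorials.
-- The cases 59 ≤ n ≤ 98 are computed.
--
-- There are no reals: expΛ and expψ are the exponentials of the von Mangoldt function
-- and of Chebyshev's ψ, and all inequalities are between natural numbers.

-- The ratio 9/8 is what shapes the proof. From n < 3p only p and 2p are multiples of p up to n, and
-- with r = n - 2p the condition 3r/2 > p - 1 is 8p ≤ 3n + 1; so a prime is needed between n/3 and
-- 9/8 of it. Bertrand's postulate is too weak for this, and so are Chebyshev's own bounds: the
-- constants they yield have quotient 6/5. Hence the longer quotients of factorials, in which
-- further ψ terms appear on both sides and are estimated by the bounds obtained before. Such a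
-- ψ-inequality needs only finitely many checks: it compares exponents that depend on ⌊x/k⌋ alone
-- and whose difference is eventually periodic. The bounds keep explicit additive constants; these
-- grow with each round of the iteration and are the reason why the list of primes has to reach so
-- far.

open import Defs
open import Data.Bool using (Bool; true; false; T; _∧_; if_then_else_)
open import Data.Integer as ℤ using (+_)
open import Data.Integer.Properties as ℤ using ()
open import Data.List using (List; []; _∷_; map; length; filter; upTo; _++_; cartesianProduct)
open import Data.List.Membership.Propositional using (_∈_)
open import Data.List.Membership.Propositional.Properties
open import Data.List.Properties using (length-map; length-++; length-upTo)
open import Data.List.Relation.Unary.All as All using (All; []; _∷_; all?)
open import Data.List.Relation.Unary.AllPairs using ([]; _∷_)
open import Data.List.Relation.Unary.Any using (here; there)
open import Data.List.Relation.Unary.Unique.Propositional using (Unique)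
open import Data.List.Relation.Unary.Unique.Propositional.Properties as Unique using ()
open import Data.Nat
open import Data.Nat.DivMod
open import Data.Nat.Divisibility
open import Data.Nat.GCD using (gcd; gcd[m,n]∣m; gcd[m,n]∣n; gcd-greatest)
open import Data.Nat.Induction using (<-rec)
open import Data.Nat.ListAction using (sum; product)
open import Data.Nat.Primality
open import Data.Nat.Primality.Factorisation using (PrimeFactorisation; factorise)
open import Data.Nat.Properties
open import Data.Nat.Tactic.RingSolver using (solve-∀)
open import Data.Product using (∃; ∃-syntax; _×_; _,_; proj₁; proj₂)
open import Data.Rational as ℚ using (1ℚ; toℚᵘ)
open import Data.Rational.Properties as ℚ using ()
open import Data.Rational.Unnormalised as ℚᵘ using (mkℚᵘ; *≡*; 1ℚᵘ; _≃_)
open import Data.Rational.Unnormalised.Properties as ℚᵘ using ()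
open import Data.Sum using (_⊎_; inj₁; inj₂)
open import Function using (_∘_)
open import Function.Bundles using (_⇔_; mk⇔)
open import Relation.Binary.Definitions using (tri<; tri≈; tri>)
open import Relation.Binary.PropositionalEquality
open import Relation.Nullary using (Dec; yes; no; does; ¬_; contradiction)
open import Relation.Nullary.Decidable using (True; toWitness; from-yes; map′; ¬?; _×-dec_; _→-dec_)

-- The von Mangoldt function

*-interchange : ∀ a b c d → a * b * (c * d) ≡ a * c * (b * d)
*-interchange = solve-∀

∏ : ℕ → (ℕ → ℕ) → ℕ
∏ zero    f = 1
∏ (suc n) f = ∏ n f * f n

∏-cong : ∀ n {f g} → (∀ i → i < n → f i ≡ g i) → ∏ n f ≡ ∏ n g
∏-cong zero    eq = refl
∏-cong (suc n) eq = cong₂ _*_ (∏-cong n (λ i i<n → eq i (m<n⇒m<1+n i<n))) (eq n ≤-refl)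

∏-mono : ∀ n {f g} → (∀ i → i < n → f i ≤ g i) → ∏ n f ≤ ∏ n g
∏-mono zero    le = ≤-refl
∏-mono (suc n) le = *-mono-≤ (∏-mono n (λ i i<n → le i (m<n⇒m<1+n i<n))) (le n ≤-refl)

∏-distrib-* : ∀ n f g → ∏ n (λ i → f i * g i) ≡ ∏ n f * ∏ n g
∏-distrib-* zero    f g = refl
∏-distrib-* (suc n) f g rewrite ∏-distrib-* n f g = *-interchange (∏ n f) (∏ n g) (f n) (g n)

∏-trim : ∀ {m n f} → m ≤ n → (∀ i → m ≤ i → i < n → f i ≡ 1) → ∏ n f ≡ ∏ m f
∏-trim {m} {n} {f} m≤n one = go (≤⇒≤′ m≤n) one
  where
  go : ∀ {n} → m ≤′ n → (∀ i → m ≤ i → i < n → f i ≡ 1) → ∏ n f ≡ ∏ m f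
  go ≤′-refl one = refl
  go {suc n} (≤′-step m≤′n) one = begin
    ∏ n f * f n  ≡⟨ cong₂ _*_ (go m≤′n (λ i m≤i i<n → one i m≤i (m<n⇒m<1+n i<n)))
                             (one n (≤′⇒≤ m≤′n) ≤-refl) ⟩
    ∏ m f * 1    ≡⟨ *-identityʳ _ ⟩
    ∏ m f        ∎
    where open ≡-Reasoning

∏-ones : ∀ n {f} → (∀ i → i < n → f i ≡ 1) → ∏ n f ≡ 1
∏-ones n one = ∏-trim z≤n (λ i _ → one i)

-- The Iverson bracket; it serves as an exponent that switches a factor on or off.
ind : ∀ {P : Set} → Dec P → ℕ
ind P? = if does P? then 1 else 0

ind-yes : ∀ {P : Set} (P? : Dec P) → P → ind P? ≡ 1
ind-yes (yes _) p = refl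
ind-yes (no ¬p) p = contradiction p ¬p

ind-no : ∀ {P : Set} (P? : Dec P) → ¬ P → ind P? ≡ 0
ind-no (yes p) ¬p = contradiction p ¬p
ind-no (no _)  ¬p = refl

ind-cong : ∀ {P Q : Set} (P? : Dec P) (Q? : Dec Q) → (P → Q) → (Q → P) → ind P? ≡ ind Q?
ind-cong P? (yes q) P⇒Q Q⇒P = ind-yes P? (Q⇒P q)
ind-cong P? (no ¬q) P⇒Q Q⇒P = ind-no P? (¬q ∘ P⇒Q)

∏-point : ∀ {n j} p → j < n → ∏ n (λ i → p ^ ind (suc i ≟ suc j)) ≡ p
∏-point {n} {j} p j<n = begin
  ∏ n δ          ≡⟨ ∏-trim j<n (λ i j<i _ → off i (>⇒≢ j<i)) ⟩
  ∏ j δ * δ j    ≡⟨ cong₂ _*_ (∏-ones j (λ i i<j → off i (<⇒≢ i<j))) on ⟩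
  1 * p          ≡⟨ *-identityˡ p ⟩
  p              ∎
  where
  open ≡-Reasoning
  δ : ℕ → ℕ
  δ i = p ^ ind (suc i ≟ suc j)
  off : ∀ i → i ≢ j → δ i ≡ 1
  off i i≢j = cong (p ^_) (ind-no (suc i ≟ suc j) (i≢j ∘ suc-injective))
  on : δ j ≡ p
  on = trans (cong (p ^_) (ind-yes (suc j ≟ suc j) refl)) (*-identityʳ p)

prime>1 : ∀ {p} → Prime p → 1 < p
prime>1 pr = nonTrivial⇒n>1 _ {{prime⇒nonTrivial pr}}

n<p^n : ∀ {p} → 1 < p → ∀ n → n < p ^ n
n<p^n 1<p zero = s≤s z≤n
n<p^n {p} 1<p (suc n) = begin-strict
  suc n          ≤⟨ n<p^n 1<p n ⟩
  p ^ n          ≡⟨ *-identityˡ _ ⟨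
  1 * p ^ n      <⟨ *-monoˡ-< (p ^ n) {{m^n≢0 p n {{>-nonZero (<-trans z<s 1<p)}}}} 1<p ⟩
  p * p ^ n      ∎
  where open ≤-Reasoning

^-cancelʳ-< : ∀ {p a b} → 1 < p → p ^ a < p ^ b → a < b
^-cancelʳ-< {p} {a} {b} 1<p lt with a <? b
... | yes a<b = a<b
... | no a≮b  = contradiction lt (≤⇒≯ (^-monoʳ-≤ p {{>-nonZero (<-trans z<s 1<p)}} (≮⇒≥ a≮b)))

^-cancelʳ-≤ : ∀ {p a b} → 1 < p → p ^ a ≤ p ^ b → a ≤ b
^-cancelʳ-≤ {p} {a} {b} 1<p le with a ≤? b
... | yes a≤b = a≤b
... | no a≰b  = contradiction le (<⇒≱ (^-monoʳ-< p 1<p (≰⇒> a≰b)))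

p∣p^1+n : ∀ p n → p ∣ p ^ suc n
p∣p^1+n p n = m∣m*n (p ^ n)

prime∣prime⇒≡ : ∀ {p q} → Prime p → Prime q → p ∣ q → p ≡ q
prime∣prime⇒≡ pp pq p∣q with prime⇒irreducible pq p∣q
... | inj₁ refl = contradiction pp ¬prime[1]
... | inj₂ p≡q  = p≡q

prime∣^⇒∣ : ∀ {p} m n → Prime p → p ∣ m ^ n → p ∣ m
prime∣^⇒∣ m zero    pp p∣1 = contradiction (subst Prime (∣1⇒≡1 p∣1) pp) ¬prime[1]
prime∣^⇒∣ m (suc n) pp p∣  with euclidsLemma m (m ^ n) pp p∣
... | inj₁ p∣m  = p∣m
... | inj₂ p∣mⁿ = prime∣^⇒∣ m n pp p∣mⁿ

^-∣-cancel : ∀ {r p} m → Prime r → ¬ (r ∣ p) → ∀ n → r ^ n ∣ p * m → r ^ n ∣ m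
^-∣-cancel m pr r∤p zero _ = 1∣ m
^-∣-cancel {r} {p} m pr r∤p (suc n) r^∣pm
  with divides t refl ← ^-∣-cancel m pr r∤p n (∣-trans (n∣m*n r) r^∣pm)
  with euclidsLemma p t pr (*-cancelʳ-∣ (r ^ n) {{m^n≢0 r n {{prime⇒nonZero pr}}}}
         (subst (r * r ^ n ∣_) (sym (*-assoc p t (r ^ n))) r^∣pm))
... | inj₁ r∣p = contradiction r∣p r∤p
... | inj₂ r∣t = *-monoˡ-∣ (r ^ n) r∣t

^-monoʳ-∣ : ∀ p {m n} → m ≤ n → p ^ m ∣ p ^ n
^-monoʳ-∣ p {m} {n} m≤n = divides (p ^ (n ∸ m)) (begin
  p ^ n                    ≡⟨ cong (p ^_) (m∸n+n≡m m≤n) ⟨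
  p ^ (n ∸ m + m)          ≡⟨ ^-distribˡ-+-* p (n ∸ m) m ⟩
  p ^ (n ∸ m) * p ^ m      ∎)
  where open ≡-Reasoning

-- The bounds p ≤ k and j < k make the predicate decidable by bounded search.
PrimePower : ℕ → Set
PrimePower k = ∃ λ p → p < suc k × Prime p × ∃ λ j → j < k × k ≡ p ^ suc j

abstract
  -- `abstract` keeps type checking from unfolding the bounded search wherever `expΛ` occurs.
  primePower? : ∀ k → Dec (PrimePower k)
  primePower? k =
    anyUpTo? (λ p → prime? p ×-dec anyUpTo? (λ j → k ≟ p ^ suc j) k) (suc k)

primePower : ∀ {p} → Prime p → ∀ j → PrimePower (p ^ suc j)
primePower {p} pp j =
  p , s≤s (∣⇒≤ {{m^n≢0 p (suc j) {{prime⇒nonZero pp}}}} (p∣p^1+n p j)) ,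
  pp , j , <-trans ≤-refl (n<p^n (prime>1 pp) (suc j)) , refl

expΛ : ℕ → ℕ
expΛ k with primePower? k
... | yes (p , _) = p
... | no _        = 1

expΛ-primePower : ∀ {p} → Prime p → ∀ j → expΛ (p ^ suc j) ≡ p
expΛ-primePower {p} pp j with primePower? (p ^ suc j)
... | yes (q , _ , pq , i , _ , eq) =
  prime∣prime⇒≡ pq pp (prime∣^⇒∣ p (suc j) pq (subst (q ∣_) (sym eq) (p∣p^1+n q i)))
... | no ¬pp = contradiction (primePower pp j) ¬pp

expΛ-¬primePower : ∀ {k} → ¬ PrimePower k → expΛ k ≡ 1
expΛ-¬primePower {k} ¬pp with primePower? k
... | yes pp = contradiction pp ¬pp
... | no _   = refl

¬primePower[1] : ¬ PrimePower 1
¬primePower[1] (p , _ , pp , j , _ , eq)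
  with refl ← ∣1⇒≡1 (subst (p ∣_) (sym eq) (p∣p^1+n p j)) = ¬prime[1] pp

expΛ[1]≡1 : expΛ 1 ≡ 1
expΛ[1]≡1 = expΛ-¬primePower ¬primePower[1]

expΛ≥1 : ∀ k → 1 ≤ expΛ k
expΛ≥1 k with primePower? k
... | yes (_ , _ , pp , _) = <⇒≤ (prime>1 pp)
... | no _                 = ≤-refl

maxPower : ∀ {p m} .{{_ : NonZero m}} → 1 < p → ∃ λ v → p ^ v ∣ m × ¬ (p ^ suc v ∣ m)
-- The search descends from exponent `m`, where `m < p ^ m` excludes divisibility.
maxPower {p} {m} 1<p = go m (λ p^m∣m → <⇒≱ (n<p^n 1<p m) (∣⇒≤ p^m∣m))
  where
  go : ∀ n → ¬ (p ^ n ∣ m) → ∃ λ v → p ^ v ∣ m × ¬ (p ^ suc v ∣ m)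
  go zero ¬1∣m = contradiction (1∣ m) ¬1∣m
  go (suc n) p^1+n∤m with p ^ n ∣? m
  ... | yes p^n∣m = n , p^n∣m , p^1+n∤m
  ... | no  p^n∤m = go n p^n∤m

-- The step from `m` to `p * m` adds a single prime power to the divisors, `p ^ suc v`. Any other
-- prime power dividing `p * m` belongs to a different prime or has a smaller exponent, and so
-- divides `m` already.
expΛ-divisor-step : ∀ {p m v} → Prime p → p ^ v ∣ m → ¬ (p ^ suc v ∣ m) → ∀ k →
  expΛ k ^ ind (k ∣? p * m) ≡
  expΛ k ^ ind (k ∣? m) * p ^ ind (k ≟ p ^ suc v)
expΛ-divisor-step {p} {m} {v} pp p^v∣m p^1+v∤m k with primePower? k
... | no ¬pp = trans (^-zeroˡ (ind (k ∣? p * m))) (sym (cong₂ _*_ (^-zeroˡ (ind (k ∣? m))) not-new))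
  where
  not-new : p ^ ind (k ≟ p ^ suc v) ≡ 1
  not-new = cong (p ^_) (ind-no (k ≟ p ^ suc v) λ { refl → ¬pp (primePower pp v) })
... | yes (r , _ , pr , j , _ , refl) with r ^ suc j ≟ p ^ suc v
...   | yes eq = begin
  r ^ ind (r ^ suc j ∣? p * m)    ≡⟨ cong (r ^_) (ind-yes (r ^ suc j ∣? p * m)
                                       (subst (_∣ p * m) (sym eq) (*-monoʳ-∣ p p^v∣m))) ⟩
  r ^ 1                           ≡⟨ *-identityʳ r ⟩
  r                               ≡⟨ r≡p ⟩
  p                               ≡⟨ *-identityˡ p ⟨
  1 * p                           ≡⟨ cong (λ e → r ^ e * p) (ind-no (r ^ suc j ∣? m)
                                       (p^1+v∤m ∘ subst (_∣ m) eq)) ⟨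
  r ^ ind (r ^ suc j ∣? m) * p    ≡⟨ cong (r ^ ind (r ^ suc j ∣? m) *_)
                                       (trans (cong (p ^_) (ind-yes (r ^ suc j ≟ p ^ suc v) eq)) (*-identityʳ p)) ⟨
  r ^ ind (r ^ suc j ∣? m) * p ^ ind (r ^ suc j ≟ p ^ suc v)    ∎
  where
  open ≡-Reasoning
  r≡p : r ≡ p
  r≡p = prime∣prime⇒≡ pr pp (prime∣^⇒∣ p (suc v) pr (subst (r ∣_) eq (p∣p^1+n r j)))
...   | no neq = begin
  r ^ ind (r ^ suc j ∣? p * m)    ≡⟨ cong (r ^_) (ind-cong (r ^ suc j ∣? p * m) (r ^ suc j ∣? m)
                                       to (∣n⇒∣m*n p)) ⟩
  r ^ ind (r ^ suc j ∣? m)        ≡⟨ *-identityʳ _ ⟨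
  r ^ ind (r ^ suc j ∣? m) * 1    ≡⟨ cong (λ e → r ^ ind (r ^ suc j ∣? m) * p ^ e)
                                       (ind-no (r ^ suc j ≟ p ^ suc v) neq) ⟨
  r ^ ind (r ^ suc j ∣? m) * p ^ ind (r ^ suc j ≟ p ^ suc v)    ∎
  where
  open ≡-Reasoning
  to : r ^ suc j ∣ p * m → r ^ suc j ∣ m
  to h with r ≟ p
  ... | no r≢p = ^-∣-cancel m pr (r≢p ∘ prime∣prime⇒≡ pr pp) (suc j) h
  ... | yes refl with j ≤? v
  ...   | no j≰v = contradiction
    (*-cancelˡ-∣ p {{prime⇒nonZero pp}} (∣-trans (^-monoʳ-∣ p (s≤s (≰⇒> j≰v))) h)) p^1+v∤m
  ...   | yes j≤v = ∣-trans (^-monoʳ-∣ p (≤∧≢⇒< j≤v (neq ∘ cong (λ e → p ^ suc e)))) p^v∣m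

-- The identity Σ Λ(k) = log m over the divisors k of m, by induction on the prime factorisation.
-- The range `B` is free so that products for different m can be multiplied factor by factor.
∏-expΛ-divisors-product : ∀ ps → All Prime ps → ∀ {B} → product ps ≤ B →
  ∏ B (λ i → expΛ (suc i) ^ ind (suc i ∣? product ps)) ≡ product ps
∏-expΛ-divisors-product [] [] {B} _ = ∏-ones B one
  where
  one : ∀ i → i < B → expΛ (suc i) ^ ind (suc i ∣? 1) ≡ 1
  one zero    _ = cong (_^ ind (1 ∣? 1)) expΛ[1]≡1
  one (suc i) _ = cong (expΛ (suc (suc i)) ^_) (ind-no (suc (suc i) ∣? 1) λ d → 1+n≢0 (suc-injective (∣1⇒≡1 d)))
∏-expΛ-divisors-product (p ∷ ps) (pp ∷ pps) {B} le
  with v , p^v∣m , p^1+v∤m ← maxPower {p} {product ps} {{productOfPrimes≢0 pps}} (prime>1 pp) = begin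
  ∏ B (λ i → expΛ (suc i) ^ ind (suc i ∣? p * m))
    ≡⟨ ∏-cong B (λ i _ → expΛ-divisor-step {v = v} pp p^v∣m p^1+v∤m (suc i)) ⟩
  ∏ B (λ i → f i * δ i)
    ≡⟨ ∏-distrib-* B f δ ⟩
  ∏ B f * ∏ B δ
    ≡⟨ cong₂ _*_ (∏-expΛ-divisors-product ps pps (≤-trans (m≤n*m m p) le)) δ-prod ⟩
  m * p
    ≡⟨ *-comm m p ⟩
  p * m ∎
  where
  open ≡-Reasoning
  m = product ps
  instance
    p≢0 = prime⇒nonZero pp
    m≢0 = productOfPrimes≢0 pps
  f δ : ℕ → ℕ
  f i = expΛ (suc i) ^ ind (suc i ∣? m)
  δ i = p ^ ind (suc i ≟ p ^ suc v)
  q≢0 = m^n≢0 p (suc v)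
  q≤B : p ^ suc v ≤ B
  q≤B = ≤-trans (∣⇒≤ {{m*n≢0 p m}} (*-monoʳ-∣ p p^v∣m)) le
  δ-prod : ∏ B δ ≡ p
  -- Abstracting over `p ^ suc v` exposes it as a successor, the form that `∏-point` expects.
  δ-prod with p ^ suc v | q≢0 | q≤B
  ... | suc j | _ | j<B = ∏-point p j<B

∏-expΛ-divisors : ∀ m .{{_ : NonZero m}} {B} → m ≤ B →
  ∏ B (λ i → expΛ (suc i) ^ ind (suc i ∣? m)) ≡ m
∏-expΛ-divisors m {B} m≤B = subst (λ m → m ≤ B → ∏ B (λ i → expΛ (suc i) ^ ind (suc i ∣? m)) ≡ m)
    (sym isFactorisation) (∏-expΛ-divisors-product factors factorsPrime) m≤B
  where open PrimeFactorisation (factorise m)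

-- Chebyshev's ψ

∏-∣ : ∀ n {f g} → (∀ i → i < n → f i ∣ g i) → ∏ n f ∣ ∏ n g
∏-∣ zero    d = ∣-refl
∏-∣ (suc n) d = *-pres-∣ (∏-∣ n (λ i i<n → d i (m<n⇒m<1+n i<n))) (d n ≤-refl)

expψ : ℕ → ℕ
expψ n = ∏ n (λ i → expΛ (suc i))

expψ≥1 : ∀ n → 1 ≤ expψ n
expψ≥1 n = subst (_≤ expψ n) (∏-ones n (λ _ _ → refl)) (∏-mono n (λ i _ → expΛ≥1 (suc i)))

expψ-mono : ∀ {m n} → m ≤ n → expψ m ≤ expψ n
expψ-mono m≤n = go (≤⇒≤′ m≤n)
  where
  go : ∀ {m n} → m ≤′ n → expψ m ≤ expψ n
  go ≤′-refl = ≤-refl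
  go {n = suc n} (≤′-step m≤′n) =
    ≤-trans (go m≤′n) (m≤m*n (expψ n) (expΛ (suc n)) {{>-nonZero (expΛ≥1 (suc n))}})

-- `k` is the product of `expΛ` over its own divisors, and all of these occur among the factors of
-- `expψ n`.
k∣expψ : ∀ {n} k .{{_ : NonZero k}} → k ≤ n → k ∣ expψ n
k∣expψ {n} k k≤n = subst (_∣ expψ n) (∏-expΛ-divisors k k≤n) (∏-∣ n λ i _ → ^-ind (expΛ (suc i)) (suc i ∣? k))
  where
  ^-ind : ∀ {P : Set} b (P? : Dec P) → b ^ ind P? ∣ b
  ^-ind b (yes _) = ∣-reflexive (*-identityʳ b)
  ^-ind b (no _)  = 1∣ b

-- A factor `p` enters `expψ` exactly at the powers of `p`, so the exponent `j` counts the powers up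
-- to `suc n`.
expψ-primePart : ∀ {p} → Prime p → ∀ n → ∃ λ j → ∃ λ u →
  expψ (suc n) ≡ p ^ j * u × ¬ (p ∣ u) × p ^ j ≤ suc n × suc n < p ^ suc j
expψ-primePart {p} pp zero = 0 , 1 , cong (1 *_) expΛ[1]≡1 ,
    (λ d → ¬prime[1] (subst Prime (∣1⇒≡1 d) pp)) , ≤-refl , subst (1 <_) (sym (*-identityʳ p)) (prime>1 pp)
expψ-primePart {p} pp (suc n) with expψ-primePart pp n
... | j , u , eq , p∤u , lo , hi with suc (suc n) ≟ p ^ suc j
...   | yes n≡ = suc j , u , eq′ , p∤u , ≤-reflexive (sym n≡) ,
        subst (_< p ^ suc (suc j)) (sym n≡) (^-monoʳ-< p (prime>1 pp) (n<1+n (suc j)))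
  where
  open ≡-Reasoning
  eq′ = begin
    expψ (suc n) * expΛ (suc (suc n)) ≡⟨ cong₂ _*_ eq (trans (cong expΛ n≡) (expΛ-primePower pp j)) ⟩
    p ^ j * u * p                     ≡⟨ *-comm (p ^ j * u) p ⟩
    p * (p ^ j * u)                   ≡⟨ *-assoc p (p ^ j) u ⟨
    p * p ^ j * u                     ∎
...   | no n≢ = j , u * expΛ (suc (suc n)) , trans (cong (_* expΛ (suc (suc n))) eq) (*-assoc (p ^ j) u (expΛ (suc (suc n)))) , p∤uΛ ,
        m≤n⇒m≤1+n lo , ≤∧≢⇒< hi n≢
  where
  p∤Λ : ¬ (p ∣ expΛ (suc (suc n)))
  p∤Λ p∣Λ with primePower? (suc (suc n))
  ... | no _ = ¬prime[1] (subst Prime (∣1⇒≡1 p∣Λ) pp)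
  ... | yes (r , _ , pr , i , _ , n≡) with refl ← prime∣prime⇒≡ pp pr p∣Λ =
    n≢ (trans n≡ (cong (p ^_) (≤-antisym (s≤s i≤j) (s≤s j≤i))))
    where
    i≤j : i ≤ j
    i≤j = s≤s⁻¹ (^-cancelʳ-≤ (prime>1 pp) (subst (_≤ p ^ suc j) n≡ hi))
    j≤i : j ≤ i
    j≤i = s≤s⁻¹ (^-cancelʳ-< (prime>1 pp) (subst (p ^ j <_) n≡ (s≤s lo)))
  p∤uΛ : ¬ (p ∣ u * expΛ (suc (suc n)))
  p∤uΛ d with euclidsLemma u _ pp d
  ... | inj₁ p∣u = p∤u p∣u
  ... | inj₂ p∣Λ = p∤Λ p∣Λ

-- Together with `k∣expψ` this identifies `expψ n` as the least common multiple of 1, ..., n. At a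
-- new prime power `p ^ suc i` the power of `p` reached so far is exactly `p ^ i`, and the cofactor
-- `u` is prime to `p`; so divisibility of `m` by `u` and by `p ^ suc i` combine.
expψ-least : ∀ n {m} → (∀ k → 1 ≤ k → k ≤ n → k ∣ m) → expψ n ∣ m
expψ-least zero    div = 1∣ _
expψ-least (suc n) {m} div with expψ-least n (λ k 1≤k k≤n → div k 1≤k (m≤n⇒m≤1+n k≤n)) | primePower? (suc n)
... | ψ∣m | no _ = subst (_∣ m) (sym (*-identityʳ (expψ n))) ψ∣m
... | ψ∣m | yes (p , _ , pp , i , _ , n≡) with n
...   | zero = contradiction pp (subst (λ q → ¬ Prime q) (sym (∣1⇒≡1 (subst (p ∣_) (sym n≡) (p∣p^1+n p i)))) ¬prime[1])
...   | suc n with expψ-primePart pp n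
...     | j , u , eq , p∤u , lo , hi = lemma ψ∣m
  where
  i≤j : i ≤ j
  i≤j = s≤s⁻¹ (^-cancelʳ-≤ (prime>1 pp) (subst (_≤ p ^ suc j) n≡ hi))
  j≤i : j ≤ i
  j≤i = s≤s⁻¹ (^-cancelʳ-< (prime>1 pp) (subst (p ^ j <_) n≡ (s≤s lo)))
  lemma : expψ (suc n) ∣ m → expψ (suc n) * p ∣ m
  lemma d with divides t refl ← ∣-trans (n∣m*n (p ^ j)) (subst (_∣ m) eq d) = subst (_∣ t * u) (sym eq′)
      (*-monoˡ-∣ u (^-∣-cancel t pp p∤u (suc i)
        (subst₂ _∣_ n≡ (*-comm t u) (div (suc (suc n)) (s≤s z≤n) ≤-refl))))
    where
    open ≡-Reasoning
    eq′ : expψ (suc n) * p ≡ p ^ suc i * u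
    eq′ = begin
      expψ (suc n) * p    ≡⟨ cong (_* p) eq ⟩
      p ^ j * u * p       ≡⟨ *-comm (p ^ j * u) p ⟩
      p * (p ^ j * u)     ≡⟨ *-assoc p (p ^ j) u ⟨
      p ^ suc j * u       ≡⟨ cong (λ e → p ^ suc e * u) (≤-antisym i≤j j≤i) ⟨
      p ^ suc i * u       ∎

-- By `expψ-least` it is enough that every `k ≤ b` divides the right-hand side. A `k > a` other than
-- 1 is composite; of two proper factors one is at most `s`, since `suc s` squared exceeds `b`, and
-- the other is at most b/2 ≤ a. This takes the place of the usual passage from ψ to θ.
expψ-primeFree : ∀ {a b s} → a ≤ b → b ≤ 2 * a → b < suc s * suc s →
  (∀ p → a < p → p ≤ b → ¬ Prime p) → expψ b ∣ expψ a * expψ s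
expψ-primeFree {a} {b} {s} a≤b b≤2a b<s² noPrime = expψ-least b div
  where
  split : ∀ {d e} → 1 < d → 1 < e → d * e ≤ b → d * e ∣ expψ a * expψ s
  split {d} {e} 1<d 1<e de≤b with d ≤? s
  ... | yes d≤s = subst (_∣ expψ a * expψ s) (*-comm e d)
        (*-pres-∣ (k∣expψ e (half 1<d de≤b)) (k∣expψ d d≤s))
    where
    instance
      _ = >-nonZero (<⇒≤ 1<d)
      _ = >-nonZero (<⇒≤ 1<e)
    half : ∀ {d e} → 1 < d → d * e ≤ b → e ≤ a
    half {d} {e} 1<d le = *-cancelˡ-≤ 2 (≤-trans (*-monoˡ-≤ e 1<d) (≤-trans le b≤2a))
  ... | no d≰s with e ≤? s
  ...   | yes e≤s = *-pres-∣ (k∣expψ d (half 1<e de≤b)) (k∣expψ e e≤s)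
    where
    instance
      _ = >-nonZero (<⇒≤ 1<d)
      _ = >-nonZero (<⇒≤ 1<e)
    half : ∀ {d e} → 1 < e → d * e ≤ b → d ≤ a
    half {d} {e} 1<e le = *-cancelˡ-≤ 2 (≤-trans (subst (2 * d ≤_) (*-comm e d) (*-monoˡ-≤ d 1<e)) (≤-trans le b≤2a))
  ...   | no e≰s = contradiction (≤-trans (*-mono-≤ (≰⇒> d≰s) (≰⇒> e≰s)) de≤b) (<⇒≱ b<s²)
  div : ∀ k → 1 ≤ k → k ≤ b → k ∣ expψ a * expψ s
  div k@(suc _) 1≤k k≤b with k ≤? a
  ... | yes k≤a = ∣m⇒∣m*n (expψ s) (k∣expψ k k≤a)
  ... | no k≰a with k
  ...   | 1 = 1∣ _
  ...   | k@(suc (suc _)) with composite? k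
  ...     | no ¬c = contradiction (¬composite⇒prime ¬c) (noPrime k (≰⇒> k≰a) k≤b)
  ...     | yes (composite {d = d} d<k d∣k@(divides e k≡ed)) =
    subst (_∣ expψ a * expψ s) (sym k≡ed) (split (quotient>1 d∣k d<k) (nonTrivial⇒n>1 d) (subst (_≤ b) k≡ed k≤b))

-- Quotients of factorials

*≤⇒≤/ : ∀ {q m} n .{{_ : NonZero n}} → q * n ≤ m → q ≤ m / n
*≤⇒≤/ {q} n qn≤m = subst (_≤ _) (m*n/n≡m q n) (/-monoˡ-≤ n qn≤m)

m<[1+m/n]*n : ∀ m n .{{_ : NonZero n}} → m < suc (m / n) * n
m<[1+m/n]*n m n = begin-strict
  m                    ≡⟨ m≡m%n+[m/n]*n m n ⟩
  m % n + m / n * n    <⟨ +-monoˡ-< (m / n * n) (m%n<n m n) ⟩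
  n + m / n * n        ∎
  where open ≤-Reasoning

suc-/ : ∀ m k .{{_ : NonZero k}} → suc m / k ≡ m / k + ind (k ∣? suc m)
suc-/ m k with k ∣? suc m
... | yes (divides q eq) = begin-equality
  suc m / k    ≡⟨ cong (_/ k) eq ⟩
  q * k / k    ≡⟨ m*n/n≡m q k ⟩
  q            ≡⟨ ≤-antisym q≤ (m<n*o⇒m/o<n (≤-reflexive eq)) ⟩
  suc (m / k)  ≡⟨ +-comm 1 (m / k) ⟩
  m / k + 1    ∎
  where
  open ≤-Reasoning
  q≤ : q ≤ suc (m / k)
  q≤ = *-cancelʳ-≤ q (suc (m / k)) k (subst (_≤ suc (m / k) * k) eq (m<[1+m/n]*n m k))
... | no k∤ = trans (≤-antisym le (/-monoˡ-≤ k (n≤1+n m))) (sym (+-identityʳ _))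
  where
  le : suc m / k ≤ m / k
  le = *≤⇒≤/ k (s≤s⁻¹ (≤∧≢⇒< (m/n*n≤m (suc m) k) (λ eq → k∤ (divides (suc m / k) (sym eq)))))

-- Legendre's formula for all primes at once, log n! = Σ Λ(k) ⌊n/k⌋: the exponent ⌊n/k⌋ rises by one
-- exactly when `k` divides the new factor.
!≡∏expΛ : ∀ n {B} → n ≤ B → n ! ≡ ∏ B (λ i → expΛ (suc i) ^ (n / suc i))
!≡∏expΛ zero    {B} _   = sym (∏-ones B (λ i _ → cong (expΛ (suc i) ^_) (0/n≡0 (suc i))))
!≡∏expΛ (suc n) {B} n<B = begin
  suc n * n !
    ≡⟨ *-comm (suc n) (n !) ⟩
  n ! * suc n
    ≡⟨ cong₂ _*_ (!≡∏expΛ n (<⇒≤ n<B)) (sym (∏-expΛ-divisors (suc n) n<B)) ⟩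
  ∏ B (λ i → expΛ (suc i) ^ (n / suc i)) * ∏ B (λ i → expΛ (suc i) ^ ind (suc i ∣? suc n))
    ≡⟨ ∏-distrib-* B _ _ ⟨
  ∏ B (λ i → expΛ (suc i) ^ (n / suc i) * expΛ (suc i) ^ ind (suc i ∣? suc n))
    ≡⟨ ∏-cong B (λ i _ → trans (sym (^-distribˡ-+-* (expΛ (suc i)) (n / suc i) _))
                               (cong (expΛ (suc i) ^_) (sym (suc-/ n (suc i))))) ⟩
  ∏ B (λ i → expΛ (suc i) ^ (suc n / suc i)) ∎
  where open ≡-Reasoning

-- The exponent is the indicator of k ≤ n; in this shape ψ can be compared with factorials.
expψ≡∏expΛ : ∀ n {B} → n ≤ B → expψ n ≡ ∏ B (λ i → expΛ (suc i) ^ (1 ⊓ (n / suc i)))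
expψ≡∏expΛ n {B} n≤B = sym (begin
  ∏ B (λ i → expΛ (suc i) ^ (1 ⊓ (n / suc i)))
    ≡⟨ ∏-trim n≤B (λ i n≤i _ → cong (λ e → expΛ (suc i) ^ (1 ⊓ e)) (m<n⇒m/n≡0 (s≤s n≤i))) ⟩
  ∏ n (λ i → expΛ (suc i) ^ (1 ⊓ (n / suc i)))
    ≡⟨ ∏-cong n (λ i i<n → trans (cong (expΛ (suc i) ^_) (m≤n⇒m⊓n≡m (m≥n⇒m/n>0 i<n))) (*-identityʳ _)) ⟩
  expψ n ∎)
  where open ≡-Reasoning

-- Division with the junk value m ÷ 0 = 0.
infixl 7 _÷_
_÷_ : ℕ → ℕ → ℕ
m ÷ zero  = 0
m ÷ suc n = m / suc n

÷-≤ : ∀ m n → m ÷ n ≤ m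
÷-≤ m zero    = z≤n
÷-≤ m (suc n) = m/n≤m m (suc n)

÷-/-comm : ∀ m n k .{{_ : NonZero k}} → m ÷ n / k ≡ (m / k) ÷ n
÷-/-comm m zero    k = 0/n≡0 k
÷-/-comm m (suc n) k = begin
  m / suc n / k      ≡⟨ m/n/o≡m/[n*o] m (suc n) k ⟩
  m / (suc n * k)    ≡⟨ /-congʳ (*-comm (suc n) k) ⟩
  m / (k * suc n)    ≡⟨ m/n/o≡m/[n*o] m k (suc n) ⟨
  m / k / suc n      ∎
  where
  open ≡-Reasoning
  instance
    _ = m*n≢0 (suc n) k
    _ = m*n≢0 k (suc n)

-- With u = ⌊x/k⌋, the factor expΛ k occurs in ∏ ⌊x/d⌋! with exponent Σ ⌊u/d⌋
-- and in ∏ expψ ⌊x/d⌋ with exponent #{d : d ≤ u}.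
factorials chebyshevs : ℕ → List ℕ → ℕ
factorials x ds = product (map (λ d → (x ÷ d) !) ds)
chebyshevs x ds = product (map (λ d → expψ (x ÷ d)) ds)

floors jumps : ℕ → List ℕ → ℕ
floors u ds = sum (map (u ÷_) ds)
jumps u ds = sum (map (λ d → 1 ⊓ (u ÷ d)) ds)

-- Serves factorials (`g` the identity) and ψ (`g = 1 ⊓_`) alike. Since ⌊⌊x/d⌋/k⌋ = ⌊⌊x/k⌋/d⌋, the
-- exponent of `expΛ k` depends on `x` only through ⌊x/k⌋.
product-∏expΛ : ∀ x (f : ℕ → ℕ) (g : ℕ → ℕ) →
  (∀ n → n ≤ x → f n ≡ ∏ x (λ i → expΛ (suc i) ^ g (n / suc i))) → ∀ ds →
  product (map (λ d → f (x ÷ d)) ds) ≡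
  ∏ x (λ i → expΛ (suc i) ^ sum (map (λ d → g ((x / suc i) ÷ d)) ds))
product-∏expΛ x f g f≡ []       = sym (∏-ones x (λ _ _ → refl))
product-∏expΛ x f g f≡ (d ∷ ds) = begin
  f (x ÷ d) * product (map (λ d → f (x ÷ d)) ds)
    ≡⟨ cong₂ _*_ (f≡ (x ÷ d) (÷-≤ x d)) (product-∏expΛ x f g f≡ ds) ⟩
  ∏ x (λ i → expΛ (suc i) ^ g (x ÷ d / suc i)) * ∏ x (λ i → expΛ (suc i) ^ s i)
    ≡⟨ ∏-distrib-* x _ _ ⟨
  ∏ x (λ i → expΛ (suc i) ^ g (x ÷ d / suc i) * expΛ (suc i) ^ s i)
    ≡⟨ ∏-cong x (λ i _ → trans (sym (^-distribˡ-+-* (expΛ (suc i)) (g (x ÷ d / suc i)) (s i)))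
         (cong (λ e → expΛ (suc i) ^ (g e + s i)) (÷-/-comm x d (suc i)))) ⟩
  ∏ x (λ i → expΛ (suc i) ^ (g ((x / suc i) ÷ d) + s i)) ∎
  where
  open ≡-Reasoning
  s : ℕ → ℕ
  s i = sum (map (λ d → g ((x / suc i) ÷ d)) ds)

-- Inequalities between exponents, decided on finitely many values

Dominated : (P A N B : List ℕ) → Set
Dominated P A N B = ∀ u → floors u P + jumps u A ≤ floors u N + jumps u B

dominated⇒≤ : ∀ {P A N B} → Dominated P A N B → ∀ x →
  factorials x P * chebyshevs x A ≤ factorials x N * chebyshevs x B
dominated⇒≤ {P} {A} {N} {B} dom x = subst₂ _≤_ (sym (expand P A)) (sym (expand N B))
  (∏-mono x (λ i _ → ^-monoʳ-≤ (expΛ (suc i)) {{>-nonZero (expΛ≥1 (suc i))}} (dom (x / suc i))))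
  where
  open ≡-Reasoning
  expand : ∀ P A → factorials x P * chebyshevs x A ≡
    ∏ x (λ i → expΛ (suc i) ^ (floors (x / suc i) P + jumps (x / suc i) A))
  expand P A = begin
    factorials x P * chebyshevs x A
      ≡⟨ cong₂ _*_ (product-∏expΛ x _! (λ n → n) (λ n → !≡∏expΛ n) P)
                   (product-∏expΛ x expψ (1 ⊓_) (λ n → expψ≡∏expΛ n) A) ⟩
    ∏ x (λ i → expΛ (suc i) ^ floors (x / suc i) P) * ∏ x (λ i → expΛ (suc i) ^ jumps (x / suc i) A)
      ≡⟨ ∏-distrib-* x _ _ ⟨
    ∏ x (λ i → expΛ (suc i) ^ floors (x / suc i) P * expΛ (suc i) ^ jumps (x / suc i) A)
      ≡⟨ ∏-cong x (λ i _ → sym (^-distribˡ-+-* (expΛ (suc i)) (floors (x / suc i) P) _)) ⟩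
    ∏ x (λ i → expΛ (suc i) ^ (floors (x / suc i) P + jumps (x / suc i) A)) ∎

floors-+ : ∀ u {L} ds → All (_∣ L) ds → floors (u + L) ds ≡ floors u ds + floors L ds
floors-+ u []           []          = refl
floors-+ u {L} (d ∷ ds) (d∣L ∷ ds∣L) = begin
  (u + L) ÷ d + floors (u + L) ds                  ≡⟨ cong₂ _+_ (one d d∣L) (floors-+ u ds ds∣L) ⟩
  u ÷ d + L ÷ d + (floors u ds + floors L ds)      ≡⟨ +-interchange (u ÷ d) (L ÷ d) _ _ ⟩
  u ÷ d + floors u ds + (L ÷ d + floors L ds)      ∎
  where
  open ≡-Reasoning
  +-interchange : ∀ a b c d → a + b + (c + d) ≡ a + c + (b + d)
  +-interchange = solve-∀
  one : ∀ d → d ∣ L → (u + L) ÷ d ≡ u ÷ d + L ÷ d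
  one zero    _   = refl
  one (suc d) d∣L = +-distrib-/-∣ʳ u d∣L

jumps-stable : ∀ {u v} ds → All (_≤ u) ds → u ≤ v → jumps v ds ≡ jumps u ds
jumps-stable []       []           u≤v = refl
jumps-stable {u} {v} (d ∷ ds) (d≤u ∷ ds≤u) u≤v = cong₂ _+_ (one d d≤u) (jumps-stable ds ds≤u u≤v)
  where
  one : ∀ d → d ≤ u → 1 ⊓ (v ÷ d) ≡ 1 ⊓ (u ÷ d)
  one zero    _   = refl
  one (suc d) d≤u = trans (m≤n⇒m⊓n≡m (m≥n⇒m/n>0 (≤-trans d≤u u≤v))) (sym (m≤n⇒m⊓n≡m (m≥n⇒m/n>0 d≤u)))

-- Raising `u` by `L` adds the same amount to the floors on both sides, and from `U` on the jumps
-- are constant. So an instance with `u ≥ U + L` follows from the one at `u ∸ L ≥ U`.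
dominated-periodic : ∀ {P A N B} L .{{_ : NonZero L}} U →
  All (_∣ L) P → All (_∣ L) N → All (_≤ U) A → All (_≤ U) B → floors L P ≡ floors L N →
  (∀ {u} → u < U + L → floors u P + jumps u A ≤ floors u N + jumps u B) → Dominated P A N B
dominated-periodic {P} {A} {N} {B} L U P∣L N∣L A≤U B≤U bal base = <-rec _ step
  where
  open ≤-Reasoning
  step : ∀ u → (∀ {v} → v < u → floors v P + jumps v A ≤ floors v N + jumps v B) →
    floors u P + jumps u A ≤ floors u N + jumps u B
  step u rec with u <? U + L
  ... | yes u< = base u<
  ... | no u≮ = subst (λ u → floors u P + jumps u A ≤ floors u N + jumps u B) (m∸n+n≡m L≤u) (begin
    floors (v + L) P + jumps (v + L) A          ≡⟨ cong₂ _+_ (floors-+ v P P∣L) (jumps-stable A (up A≤U) (m≤m+n v L)) ⟩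
    floors v P + floors L P + jumps v A         ≡⟨ shuffle (floors v P) _ _ ⟩
    floors v P + jumps v A + floors L P         ≤⟨ +-mono-≤ (rec v<u) (≤-reflexive bal) ⟩
    floors v N + jumps v B + floors L N         ≡⟨ shuffle (floors v N) _ _ ⟨
    floors v N + floors L N + jumps v B         ≡⟨ cong₂ _+_ (floors-+ v N N∣L) (jumps-stable B (up B≤U) (m≤m+n v L)) ⟨
    floors (v + L) N + jumps (v + L) B          ∎)
    where
    v = u ∸ L
    U≤v : U ≤ v
    U≤v = m+n≤o⇒m≤o∸n U (≮⇒≥ u≮)
    L≤u : L ≤ u
    L≤u = ≤-trans (m≤n+m L U) (≮⇒≥ u≮)
    v<u : v < u
    v<u = ∸-monoʳ-< (>-nonZero⁻¹ L) L≤u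
    shuffle : ∀ a b c → a + b + c ≡ a + c + b
    shuffle = solve-∀
    up : ∀ {ds} → All (_≤ U) ds → All (_≤ v) ds
    up []       = []
    up (p ∷ ps) = ≤-trans p U≤v ∷ up ps

-- For a common multiple `L`, `floors L` is L Σ 1/d. Equality of the sums makes the difference of
-- the floors periodic and also cancels the terms of order x log x in Stirling's formula.
Balanced : ℕ → List ℕ → List ℕ → Set
Balanced L P N = All (_∣ L) P × All (_∣ L) N × floors L P ≡ floors L N

balanced? : ∀ L P N → Dec (Balanced L P N)
balanced? L P N = all? (_∣? L) P ×-dec all? (_∣? L) N ×-dec floors L P ≟ floors L N

DominatedBelow : (L U : ℕ) (P A N B : List ℕ) → Set
DominatedBelow L U P A N B = Balanced L P N × All (_≤ U) A × All (_≤ U) B ×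
  (∀ {u} → u < U + L → floors u P + jumps u A ≤ floors u N + jumps u B)

dominatedBelow? : ∀ L U P A N B → Dec (DominatedBelow L U P A N B)
dominatedBelow? L U P A N B = balanced? L P N ×-dec all? (_≤? U) A ×-dec all? (_≤? U) B ×-dec
  allUpTo? (λ u → floors u P + jumps u A ≤? floors u N + jumps u B) (U + L)

dominated-check : ∀ L .{{_ : NonZero L}} U P A N B → True (dominatedBelow? L U P A N B) → Dominated P A N B
dominated-check L U P A N B check
  with (P∣L , N∣L , balanced) , A≤U , B≤U , below ← toWitness {a? = dominatedBelow? L U P A N B} check
  = dominated-periodic L U P∣L N∣L A≤U B≤U balanced below

-- Bounds for factorials

-- Bernoulli's inequality for the powers of 1 + 1/d, cleared of fractions.
bernoulli-lower : ∀ d n → d ^ suc n + suc n * d ^ n ≤ suc d ^ suc n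
bernoulli-lower d zero    = ≤-reflexive (base d)
  where
  base : ∀ d → d * 1 + 1 * 1 ≡ suc d * 1
  base = solve-∀
bernoulli-lower d (suc n) = begin
  d * (d * D) + suc (suc n) * (d * D)
    ≤⟨ m≤m+n _ (suc n * D) ⟩
  d * (d * D) + suc (suc n) * (d * D) + suc n * D
    ≡⟨ expand d D n ⟩
  suc d * (d * D + suc n * D)
    ≤⟨ *-monoʳ-≤ (suc d) (bernoulli-lower d n) ⟩
  suc d * suc d ^ suc n ∎
  where
  open ≤-Reasoning
  D = d ^ n
  expand : ∀ d D n → d * (d * D) + suc (suc n) * (d * D) + suc n * D ≡ suc d * (d * D + suc n * D)
  expand = solve-∀

-- Bernoulli's inequality for the powers of 1 - 1/(d + 1), cleared of fractions.
bernoulli-upper : ∀ d n → suc d ^ suc n ≤ d ^ suc n + suc n * suc d ^ n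
bernoulli-upper d zero    = ≤-reflexive (base d)
  where
  base : ∀ d → suc d * 1 ≡ d * 1 + 1 * 1
  base = solve-∀
bernoulli-upper d (suc n) = begin
  suc d * suc d ^ suc n
    ≤⟨ *-monoʳ-≤ (suc d) (bernoulli-upper d n) ⟩
  suc d * (D + suc n * E)
    ≡⟨ expand d D n E ⟩
  d * D + suc n * (suc d * E) + D
    ≤⟨ +-monoʳ-≤ (d * D + suc n * (suc d * E)) (^-monoˡ-≤ (suc n) (n≤1+n d)) ⟩
  d * D + suc n * (suc d * E) + suc d * E
    ≡⟨ collect d D n E ⟩
  d * D + suc (suc n) * (suc d * E) ∎
  where
  open ≤-Reasoning
  D = d ^ suc n
  E = suc d ^ n
  expand : ∀ d D n E → suc d * (D + suc n * E) ≡ d * D + suc n * (suc d * E) + D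
  expand = solve-∀
  collect : ∀ d D n E → d * D + suc n * (suc d * E) + suc d * E ≡ d * D + suc (suc n) * (suc d * E)
  collect = solve-∀

ratio-trans : ∀ a b c d e f .{{_ : NonZero d}} → a * d ≤ c * b → c * f ≤ e * d → a * f ≤ e * b
ratio-trans a b c d e f ad≤cb cf≤ed = *-cancelʳ-≤ (a * f) (e * b) d (begin
  a * f * d      ≡⟨ shuffle a f d ⟩
  a * d * f      ≤⟨ *-monoˡ-≤ f ad≤cb ⟩
  c * b * f      ≡⟨ shuffle c b f ⟩
  c * f * b      ≤⟨ *-monoˡ-≤ b cf≤ed ⟩
  e * d * b      ≡⟨ shuffle e d b ⟩
  e * b * d      ∎)
  where
  open ≤-Reasoning
  shuffle : ∀ a b c → a * b * c ≡ a * c * b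
  shuffle = solve-∀

^-distribʳ-* : ∀ n a b → (a * b) ^ n ≡ a ^ n * b ^ n
^-distribʳ-* zero    a b = refl
^-distribʳ-* (suc n) a b = trans (cong (a * b *_) (^-distribʳ-* n a b)) (*-interchange a b (a ^ n) (b ^ n))

square-^ : ∀ k n → suc (k * suc (suc k)) ^ n ≡ suc k ^ n * suc k ^ n
square-^ k n = trans (cong (_^ n) (sq k)) (^-distribʳ-* n (suc k) (suc k))
  where
  sq : ∀ k → suc (k * suc (suc k)) ≡ suc k * suc k
  sq = solve-∀

-- With d = k(k + 2), so that d + 1 is the square of k + 1, the quotient of consecutive terms is
-- (d/(d + 1))^(k + 1) · (k + 1)/k, and `bernoulli-upper` shows it to be at least 1.
[1+1/k]^k-increasing : ∀ k → suc k ^ k * suc k ^ suc k ≤ suc (suc k) ^ suc k * k ^ k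
[1+1/k]^k-increasing zero = s≤s z≤n
[1+1/k]^k-increasing k@(suc _) = *-cancelʳ-≤ (suc k ^ k * suc k ^ suc k) _ (suc k * k) (begin
  suc k ^ k * suc k ^ suc k * (suc k * k)
    ≡⟨ shuffle₁ (suc k ^ k) k ⟩
  k * (suc k ^ suc k * suc k ^ suc k)
    ≡⟨ cong (k *_) (square-^ k (suc k)) ⟨
  k * suc d ^ suc k
    ≤⟨ +-cancelʳ-≤ (suc d ^ suc k) _ _ main ⟩
  suc k * d ^ suc k
    ≡⟨ cong (suc k *_) (^-distribʳ-* (suc k) k (suc (suc k))) ⟩
  suc k * (k ^ suc k * suc (suc k) ^ suc k)
    ≡⟨ shuffle₂ (k ^ k) (suc (suc k) ^ suc k) k ⟩
  suc (suc k) ^ suc k * k ^ k * (suc k * k) ∎)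
  where
  open ≤-Reasoning
  d = k * suc (suc k)
  shuffle₁ : ∀ A k → A * (suc k * A) * (suc k * k) ≡ k * (suc k * A * (suc k * A))
  shuffle₁ = solve-∀
  shuffle₂ : ∀ A B k → suc k * (k * A * B) ≡ B * A * (suc k * k)
  shuffle₂ = solve-∀
  shuffle₃ : ∀ k A B → suc k * (A + suc k * B) ≡ suc k * A + suc (k * suc (suc k)) * B
  shuffle₃ = solve-∀
  main : k * suc d ^ suc k + suc d ^ suc k ≤ suc k * d ^ suc k + suc d ^ suc k
  main = begin
    k * suc d ^ suc k + suc d ^ suc k           ≡⟨ +-comm _ (suc d ^ suc k) ⟩
    suc k * suc d ^ suc k                       ≤⟨ *-monoʳ-≤ (suc k) (bernoulli-upper d k) ⟩
    suc k * (d ^ suc k + suc k * suc d ^ k)     ≡⟨ shuffle₃ k (d ^ suc k) (suc d ^ k) ⟩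
    suc k * d ^ suc k + suc d ^ suc k           ∎

-- With d = j(j + 2) the quotient of consecutive terms is ((d + 1)/d)^(j + 2) · j/(j + 1), at least
-- 1 by `bernoulli-lower`.
[1+1/j]^1+j-decreasing : ∀ j →
  suc (suc j) ^ suc (suc j) * j ^ suc j ≤ suc j ^ suc j * suc j ^ suc (suc j)
[1+1/j]^1+j-decreasing zero = z≤n
[1+1/j]^1+j-decreasing j@(suc _) = *-cancelʳ-≤ (suc (suc j) ^ suc (suc j) * j ^ suc j) _ (suc j * j) (begin
  suc (suc j) ^ suc (suc j) * j ^ suc j * (suc j * j)
    ≡⟨ shuffle₁ (suc (suc j) ^ suc (suc j)) (j ^ suc j) j ⟩
  suc j * (j ^ suc (suc j) * suc (suc j) ^ suc (suc j))
    ≡⟨ cong (suc j *_) (^-distribʳ-* (suc (suc j)) j (suc (suc j))) ⟨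
  suc j * d ^ suc (suc j)
    ≡⟨ shuffle₃ j (d ^ suc j) ⟨
  j * (d ^ suc (suc j) + suc (suc j) * d ^ suc j)
    ≤⟨ *-monoʳ-≤ j (bernoulli-lower d (suc j)) ⟩
  j * suc d ^ suc (suc j)
    ≡⟨ cong (j *_) (square-^ j (suc (suc j))) ⟩
  j * (suc j ^ suc (suc j) * suc j ^ suc (suc j))
    ≡⟨ shuffle₂ (suc j ^ suc j) j ⟩
  suc j ^ suc j * suc j ^ suc (suc j) * (suc j * j) ∎)
  where
  open ≤-Reasoning
  d = j * suc (suc j)
  shuffle₁ : ∀ A B j → A * B * (suc j * j) ≡ suc j * (j * B * A)
  shuffle₁ = solve-∀
  shuffle₂ : ∀ A j → j * (suc j * A * (suc j * A)) ≡ A * (suc j * A) * (suc j * j)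
  shuffle₂ = solve-∀
  shuffle₃ : ∀ j B → j * (j * suc (suc j) * B + suc (suc j) * B) ≡ suc j * (j * suc (suc j) * B)
  shuffle₃ = solve-∀

e-separation-diagonal : ∀ k → suc k ^ k * k ^ suc k ≤ suc k ^ suc k * k ^ k
e-separation-diagonal k = subst (_≤ suc k ^ suc k * k ^ k) (shuffle (suc k ^ k) k (k ^ k))
    (*-monoˡ-≤ (k ^ k) (*-monoˡ-≤ (suc k ^ k) (n≤1+n k)))
  where
  shuffle : ∀ A k B → k * A * B ≡ A * (k * B)
  shuffle = solve-∀

-- (1 + 1/k)^k ≤ e ≤ (1 + 1/j)^(j+1); both sides are monotone, so one descends
-- from the diagonal j = k = max.
e-separation : ∀ k j → suc k ^ k * j ^ suc j ≤ suc j ^ suc j * k ^ k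
e-separation k j with ≤-total k j
... | inj₁ k≤j = descend (≤⇒≤′ k≤j) (e-separation-diagonal j)
  where
  descend : ∀ {k m} → k ≤′ m → suc m ^ m * j ^ suc j ≤ suc j ^ suc j * m ^ m →
    suc k ^ k * j ^ suc j ≤ suc j ^ suc j * k ^ k
  descend ≤′-refl h = h
  descend {m = suc m} (≤′-step k≤m) h = descend k≤m
    (ratio-trans (suc m ^ m) (m ^ m) (suc (suc m) ^ suc m) (suc m ^ suc m) (suc j ^ suc j) (j ^ suc j)
      {{m^n≢0 (suc m) (suc m)}} ([1+1/k]^k-increasing m) h)
... | inj₂ j≤k = descend (≤⇒≤′ j≤k) (e-separation-diagonal k)
  where
  descend : ∀ {j m} → j ≤′ m → suc k ^ k * m ^ suc m ≤ suc m ^ suc m * k ^ k →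
    suc k ^ k * j ^ suc j ≤ suc j ^ suc j * k ^ k
  descend ≤′-refl h = h
  descend {m = suc m} (≤′-step j≤m) h = descend j≤m
    (ratio-trans (suc k ^ k) (k ^ k) (suc (suc m) ^ suc (suc m)) (suc m ^ suc (suc m)) (suc m ^ suc m) (m ^ suc m)
      {{m^n≢0 (suc m) (suc (suc m))}} h ([1+1/j]^1+j-decreasing m))

[1+n]^n≤4n^n : ∀ n → suc n ^ n ≤ 4 * n ^ n
[1+n]^n≤4n^n n = subst (_≤ 4 * n ^ n) (*-identityʳ (suc n ^ n)) (e-separation n 1)

-- The bound (n/e)^n ≤ n! with e replaced by the larger (1 + 1/k)^(k + 1). The induction step needs
-- only that (1 + 1/n)^n stays below this number.
stirling-lower : ∀ k n → n ^ n * (k ^ suc k) ^ n ≤ n ! * (suc k ^ suc k) ^ n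
stirling-lower k zero    = ≤-refl
stirling-lower k (suc n) = begin
  suc n * suc n ^ n * (u * u ^ n)      ≡⟨ shuffle₁ (suc n) (suc n ^ n) u (u ^ n) ⟩
  suc n * (suc n ^ n * u * u ^ n)      ≤⟨ *-monoʳ-≤ (suc n) (*-monoˡ-≤ (u ^ n) (e-separation n k)) ⟩
  suc n * (w * n ^ n * u ^ n)          ≡⟨ shuffle₂ (suc n) w (n ^ n) (u ^ n) ⟩
  suc n * w * (n ^ n * u ^ n)          ≤⟨ *-monoʳ-≤ (suc n * w) (stirling-lower k n) ⟩
  suc n * w * (n ! * w ^ n)            ≡⟨ *-interchange (suc n) w (n !) (w ^ n) ⟩
  suc n * n ! * (w * w ^ n)            ∎
  where
  open ≤-Reasoning
  u = k ^ suc k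
  w = suc k ^ suc k
  shuffle₁ : ∀ s a u v → s * a * (u * v) ≡ s * (a * u * v)
  shuffle₁ = solve-∀
  shuffle₂ : ∀ s w a v → s * (w * a * v) ≡ s * w * (a * v)
  shuffle₂ = solve-∀

-- The bound n! ≤ 4(n + 1)(n/e)^n with e replaced by the smaller (1 + 1/k)^k. The induction closes
-- for (n + 1)^(n + 1), which is turned into n^n only at the end, at the price of the factor 4.
stirling-upper : ∀ k n → n ! * (suc k ^ k) ^ n ≤ 4 * suc n * (n ^ n * (k ^ k) ^ n)
stirling-upper k n = begin
  n ! * w ^ n                          ≤⟨ strong n ⟩
  suc n * suc n ^ n * u ^ n            ≤⟨ *-monoˡ-≤ (u ^ n) (*-monoʳ-≤ (suc n) ([1+n]^n≤4n^n n)) ⟩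
  suc n * (4 * n ^ n) * u ^ n          ≡⟨ shuffle (suc n) (n ^ n) (u ^ n) ⟩
  4 * suc n * (n ^ n * u ^ n)          ∎
  where
  open ≤-Reasoning
  u = k ^ k
  w = suc k ^ k
  shuffle : ∀ s a b → s * (4 * a) * b ≡ 4 * s * (a * b)
  shuffle = solve-∀
  shuffle₁ : ∀ s f w v → s * f * (w * v) ≡ s * w * (f * v)
  shuffle₁ = solve-∀
  shuffle₂ : ∀ s w a v → s * w * (a * v) ≡ w * (s * a) * v
  shuffle₂ = solve-∀
  strong : ∀ n → n ! * w ^ n ≤ suc n ^ suc n * u ^ n
  strong zero    = ≤-refl
  strong (suc n) = begin
    suc n * n ! * (w * w ^ n)                ≡⟨ shuffle₁ (suc n) (n !) w (w ^ n) ⟩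
    suc n * w * (n ! * w ^ n)                ≤⟨ *-monoʳ-≤ (suc n * w) (strong n) ⟩
    suc n * w * (suc n ^ suc n * u ^ n)      ≡⟨ shuffle₂ (suc n) w (suc n ^ suc n) (u ^ n) ⟩
    w * suc n ^ suc (suc n) * u ^ n          ≤⟨ *-monoˡ-≤ (u ^ n) (e-separation k (suc n)) ⟩
    suc (suc n) ^ suc (suc n) * u * u ^ n    ≡⟨ *-assoc (suc (suc n) ^ suc (suc n)) u (u ^ n) ⟩
    suc (suc n) ^ suc (suc n) * (u * u ^ n)  ∎

-- Its x-th power is what Stirling's formula leaves of `factorials (x * L) ds` apart from powers of
-- x and of e.
powerProduct : ℕ → List ℕ → ℕ
powerProduct L ds = product (map (λ d → (L ÷ d) ^ (L ÷ d)) ds)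

*-÷-assoc : ∀ x {L d} → d ∣ L → (x * L) ÷ d ≡ x * (L ÷ d)
*-÷-assoc x {L} {zero}  _   = sym (*-zeroʳ x)
*-÷-assoc x {L} {suc d} d∣L = *-/-assoc x d∣L

^-split : ∀ u x a s → u ^ (x * (a + s)) ≡ u ^ (x * a) * u ^ (x * s)
^-split u x a s = trans (cong (u ^_) (*-distribˡ-+ x a s)) (^-distribˡ-+-* u (x * a) (x * s))

[a^a]^x*x^xa : ∀ a x → (a ^ a) ^ x * x ^ (x * a) ≡ (x * a) ^ (x * a)
[a^a]^x*x^xa a x = begin
  (a ^ a) ^ x * x ^ (x * a)      ≡⟨ cong (_* x ^ (x * a)) (trans (^-*-assoc a a x) (cong (a ^_) (*-comm a x))) ⟩
  a ^ (x * a) * x ^ (x * a)      ≡⟨ *-comm (a ^ (x * a)) _ ⟩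
  x ^ (x * a) * a ^ (x * a)      ≡⟨ ^-distribʳ-* (x * a) x a ⟨
  (x * a) ^ (x * a)              ∎
  where open ≡-Reasoning

*-interchange₃ : ∀ a b c d e f → a * b * (c * d) * (e * f) ≡ a * c * e * (b * d * f)
*-interchange₃ = solve-∀

factorials-lower : ∀ k L x ds → All (_∣ L) ds → let s = floors L ds in
  powerProduct L ds ^ x * x ^ (x * s) * (k ^ suc k) ^ (x * s) ≤
  factorials (x * L) ds * (suc k ^ suc k) ^ (x * s)
factorials-lower k L x [] [] rewrite *-zeroʳ x | ^-zeroˡ x = ≤-refl
factorials-lower k L x (d ∷ ds) (d∣L ∷ ds∣L) = begin
  (A * K) ^ x * x ^ (x * (a + s)) * u ^ (x * (a + s))
    ≡⟨ cong₂ _*_ (cong₂ _*_ (^-distribʳ-* x A K) (^-split x x a s)) (^-split u x a s) ⟩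
  A ^ x * K ^ x * (x ^ (x * a) * x ^ (x * s)) * (u ^ (x * a) * u ^ (x * s))
    ≡⟨ *-interchange₃ (A ^ x) (K ^ x) (x ^ (x * a)) (x ^ (x * s)) (u ^ (x * a)) (u ^ (x * s)) ⟩
  A ^ x * x ^ (x * a) * u ^ (x * a) * (K ^ x * x ^ (x * s) * u ^ (x * s))
    ≤⟨ *-mono-≤ head (factorials-lower k L x ds ds∣L) ⟩
  ((x * L) ÷ d) ! * w ^ (x * a) * (factorials (x * L) ds * w ^ (x * s))
    ≡⟨ *-interchange (((x * L) ÷ d) !) (w ^ (x * a)) (factorials (x * L) ds) (w ^ (x * s)) ⟩
  ((x * L) ÷ d) ! * factorials (x * L) ds * (w ^ (x * a) * w ^ (x * s))
    ≡⟨ cong (((x * L) ÷ d) ! * factorials (x * L) ds *_) (^-split w x a s) ⟨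
  ((x * L) ÷ d) ! * factorials (x * L) ds * w ^ (x * (a + s)) ∎
  where
  open ≤-Reasoning
  a = L ÷ d
  s = floors L ds
  A = a ^ a
  K = powerProduct L ds
  u = k ^ suc k
  w = suc k ^ suc k
  head : A ^ x * x ^ (x * a) * u ^ (x * a) ≤ ((x * L) ÷ d) ! * w ^ (x * a)
  head = begin
    A ^ x * x ^ (x * a) * u ^ (x * a)    ≡⟨ cong (_* u ^ (x * a)) ([a^a]^x*x^xa a x) ⟩
    (x * a) ^ (x * a) * u ^ (x * a)      ≤⟨ stirling-lower k (x * a) ⟩
    (x * a) ! * w ^ (x * a)              ≡⟨ cong (λ n → n ! * w ^ (x * a)) (*-÷-assoc x d∣L) ⟨
    ((x * L) ÷ d) ! * w ^ (x * a)        ∎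

factorials-upper : ∀ k L x ds → All (_∣ L) ds → let s = floors L ds in
  factorials (x * L) ds * (suc k ^ k) ^ (x * s) ≤
  (4 * suc (x * L)) ^ length ds * (powerProduct L ds ^ x * x ^ (x * s) * (k ^ k) ^ (x * s))
factorials-upper k L x [] [] rewrite *-zeroʳ x | ^-zeroˡ x = ≤-refl
factorials-upper k L x (d ∷ ds) (d∣L ∷ ds∣L) = begin
  ((x * L) ÷ d) ! * factorials (x * L) ds * w ^ (x * (a + s))
    ≡⟨ cong (((x * L) ÷ d) ! * factorials (x * L) ds *_) (^-split w x a s) ⟩
  ((x * L) ÷ d) ! * factorials (x * L) ds * (w ^ (x * a) * w ^ (x * s))
    ≡⟨ *-interchange (((x * L) ÷ d) !) (factorials (x * L) ds) (w ^ (x * a)) (w ^ (x * s)) ⟩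
  ((x * L) ÷ d) ! * w ^ (x * a) * (factorials (x * L) ds * w ^ (x * s))
    ≤⟨ *-mono-≤ head (factorials-upper k L x ds ds∣L) ⟩
  E * (A ^ x * x ^ (x * a) * u ^ (x * a)) * (E ^ length ds * (K ^ x * x ^ (x * s) * u ^ (x * s)))
    ≡⟨ *-interchange E (A ^ x * x ^ (x * a) * u ^ (x * a)) (E ^ length ds) (K ^ x * x ^ (x * s) * u ^ (x * s)) ⟩
  E * E ^ length ds * (A ^ x * x ^ (x * a) * u ^ (x * a) * (K ^ x * x ^ (x * s) * u ^ (x * s)))
    ≡⟨ cong (E * E ^ length ds *_)
         (*-interchange₃ (A ^ x) (K ^ x) (x ^ (x * a)) (x ^ (x * s)) (u ^ (x * a)) (u ^ (x * s))) ⟨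
  E * E ^ length ds * (A ^ x * K ^ x * (x ^ (x * a) * x ^ (x * s)) * (u ^ (x * a) * u ^ (x * s)))
    ≡⟨ cong (E * E ^ length ds *_)
         (cong₂ _*_ (cong₂ _*_ (^-distribʳ-* x A K) (^-split x x a s)) (^-split u x a s)) ⟨
  E * E ^ length ds * ((A * K) ^ x * x ^ (x * (a + s)) * u ^ (x * (a + s))) ∎
  where
  open ≤-Reasoning
  a = L ÷ d
  s = floors L ds
  A = a ^ a
  K = powerProduct L ds
  u = k ^ k
  w = suc k ^ k
  E = 4 * suc (x * L)
  head : ((x * L) ÷ d) ! * w ^ (x * a) ≤ E * (A ^ x * x ^ (x * a) * u ^ (x * a))
  head = begin
    ((x * L) ÷ d) ! * w ^ (x * a)              ≡⟨ cong (λ n → n ! * w ^ (x * a)) (*-÷-assoc x d∣L) ⟩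
    (x * a) ! * w ^ (x * a)                    ≤⟨ stirling-upper k (x * a) ⟩
    4 * suc (x * a) * ((x * a) ^ (x * a) * u ^ (x * a))
      ≤⟨ *-monoˡ-≤ _ (*-monoʳ-≤ 4 (s≤s (*-monoʳ-≤ x (÷-≤ L d)))) ⟩
    E * ((x * a) ^ (x * a) * u ^ (x * a))      ≡⟨ cong (λ n → E * (n * u ^ (x * a))) ([a^a]^x*x^xa a x) ⟨
    E * (A ^ x * x ^ (x * a) * u ^ (x * a))    ∎

-- Balance gives both sides the same powers of `x` and of e. The former cancel; of the latter there
-- remains the quotient 1 + 1/k of the two approximations of e.
factorials-ratio : ∀ k .{{_ : NonZero k}} L x P N → All (_∣ L) P → All (_∣ L) N →
  floors L P ≡ floors L N →
  factorials (x * L) N * powerProduct L P ^ x * k ^ (x * floors L N) ≤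
  (4 * suc (x * L)) ^ length N * powerProduct L N ^ x * factorials (x * L) P * suc k ^ (x * floors L N)
factorials-ratio k L x P N P∣L N∣L bal = *-cancelʳ-≤ _ _ (y * u ^ e * w ^ e) (begin
  FN * KP * k ^ e * (y * u ^ e * w ^ e)
    ≡⟨ shuffle₁ FN KP (k ^ e) y (u ^ e) (w ^ e) ⟩
  FN * w ^ e * (KP * y * (k ^ e * u ^ e))
    ≡⟨ cong (λ z → FN * w ^ e * (KP * y * z)) (^-distribʳ-* e k u) ⟨
  FN * w ^ e * (KP * y * (k ^ suc k) ^ e)
    ≤⟨ *-mono-≤ (factorials-upper k L x N N∣L)
         (subst (λ s → KP * x ^ (x * s) * (k ^ suc k) ^ (x * s) ≤ FP * (suc k ^ suc k) ^ (x * s)) bal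
           (factorials-lower k L x P P∣L)) ⟩
  E * (KN * y * u ^ e) * (FP * (suc k ^ suc k) ^ e)
    ≡⟨ cong (λ z → E * (KN * y * u ^ e) * (FP * z)) (^-distribʳ-* e (suc k) w) ⟩
  E * (KN * y * u ^ e) * (FP * (suc k ^ e * w ^ e))
    ≡⟨ shuffle₂ E KN FP (suc k ^ e) y (u ^ e) (w ^ e) ⟩
  E * KN * FP * suc k ^ e * (y * u ^ e * w ^ e) ∎)
  where
  open ≤-Reasoning
  e = x * floors L N
  FN = factorials (x * L) N
  FP = factorials (x * L) P
  KP = powerProduct L P ^ x
  KN = powerProduct L N ^ x
  E = (4 * suc (x * L)) ^ length N
  y = x ^ e
  u = k ^ k
  w = suc k ^ k
  y≢0 : ∀ x s → NonZero (x ^ (x * s))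
  -- For `x = 0` the exponent vanishes too, and 0 ^ 0 = 1.
  y≢0 zero    s = _
  y≢0 (suc x) s = m^n≢0 (suc x) (suc x * s)
  instance
    _ = y≢0 x (floors L N)
    _ = m^n≢0 k k
    _ = m^n≢0 (suc k) k
    _ = m^n≢0 u e
    _ = m^n≢0 w e
    _ = m*n≢0 y (u ^ e)
    _ = m*n≢0 (y * u ^ e) (w ^ e)
  shuffle₁ : ∀ FN KP k y u w → FN * KP * k * (y * u * w) ≡ FN * w * (KP * y * (k * u))
  shuffle₁ = solve-∀
  shuffle₂ : ∀ E KN FP k y u w → E * (KN * y * u) * (FP * (k * w)) ≡ E * KN * FP * k * (y * u * w)
  shuffle₂ = solve-∀

^-*-comm : ∀ a m n → (a ^ m) ^ n ≡ (a ^ n) ^ m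
^-*-comm a m n = trans (^-*-assoc a m n) (trans (cong (a ^_) (*-comm m n)) (sym (^-*-assoc a n m)))

-- The choice `k = floors L N * q` makes the q-th power of the error equal to ((1 + 1/k)^k)^x, which
-- is at most 4^x.
factorials-ratio-^ : ∀ q .{{_ : NonZero q}} L x P N → .{{_ : NonZero (floors L N)}} →
  All (_∣ L) P → All (_∣ L) N → floors L P ≡ floors L N →
  factorials (x * L) N ^ q * (powerProduct L P ^ q) ^ x ≤
  (4 * suc (x * L)) ^ (length N * q) * (powerProduct L N ^ q) ^ x * factorials (x * L) P ^ q * 4 ^ x
factorials-ratio-^ q L x P N P∣L N∣L bal = *-cancelʳ-≤ _ _ ((k ^ k) ^ x) (begin
  FN ^ q * (KP ^ q) ^ x * (k ^ k) ^ x
    ≡⟨ cong₂ (λ a b → FN ^ q * a * b) (^-*-comm KP q x) (regroup k) ⟩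
  FN ^ q * (KP ^ x) ^ q * (k ^ (x * s)) ^ q
    ≡⟨ trans (^-distribʳ-* q (FN * KP ^ x) (k ^ (x * s))) (cong (_* (k ^ (x * s)) ^ q) (^-distribʳ-* q FN (KP ^ x))) ⟨
  (FN * KP ^ x * k ^ (x * s)) ^ q
    ≤⟨ ^-monoˡ-≤ q (factorials-ratio k L x P N P∣L N∣L bal) ⟩
  (E ^ length N * KN ^ x * FP * suc k ^ (x * s)) ^ q
    ≡⟨ trans (^-distribʳ-* q (E ^ length N * KN ^ x * FP) (suc k ^ (x * s))) (cong (_* (suc k ^ (x * s)) ^ q)
         (trans (^-distribʳ-* q (E ^ length N * KN ^ x) FP) (cong (_* FP ^ q) (^-distribʳ-* q (E ^ length N) (KN ^ x))))) ⟩
  (E ^ length N) ^ q * (KN ^ x) ^ q * FP ^ q * (suc k ^ (x * s)) ^ q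
    ≡⟨ cong₂ (λ a b → a * FP ^ q * b) (cong₂ _*_ (^-*-assoc E (length N) q) (^-*-comm KN x q)) (sym (regroup (suc k))) ⟩
  E′ * (KN ^ q) ^ x * FP ^ q * (suc k ^ k) ^ x
    ≤⟨ *-monoʳ-≤ (E′ * (KN ^ q) ^ x * FP ^ q) (^-monoˡ-≤ x ([1+n]^n≤4n^n k)) ⟩
  E′ * (KN ^ q) ^ x * FP ^ q * (4 * k ^ k) ^ x
    ≡⟨ cong (E′ * (KN ^ q) ^ x * FP ^ q *_) (^-distribʳ-* x 4 (k ^ k)) ⟩
  E′ * (KN ^ q) ^ x * FP ^ q * (4 ^ x * (k ^ k) ^ x)
    ≡⟨ *-assoc (E′ * (KN ^ q) ^ x * FP ^ q) (4 ^ x) ((k ^ k) ^ x) ⟨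
  E′ * (KN ^ q) ^ x * FP ^ q * 4 ^ x * (k ^ k) ^ x ∎)
  where
  open ≤-Reasoning
  s = floors L N
  k = s * q
  FN = factorials (x * L) N
  FP = factorials (x * L) P
  KP = powerProduct L P
  KN = powerProduct L N
  E = 4 * suc (x * L)
  E′ = E ^ (length N * q)
  instance
    _ = m*n≢0 s q
    _ = m^n≢0 k k
    _ = m^n≢0 (k ^ k) x
  regroup : ∀ b → (b ^ k) ^ x ≡ (b ^ (x * s)) ^ q
  regroup b = begin-equality
    (b ^ (s * q)) ^ x     ≡⟨ ^-*-assoc b (s * q) x ⟩
    b ^ (s * q * x)       ≡⟨ cong (b ^_) (shuffle s q x) ⟩
    b ^ (x * s * q)       ≡⟨ ^-*-assoc b (x * s) q ⟨
    (b ^ (x * s)) ^ q     ∎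
    where
    shuffle : ∀ s q x → s * q * x ≡ x * s * q
    shuffle = solve-∀

n≤2^n : ∀ n → n ≤ 2 ^ n
n≤2^n n = <⇒≤ (n<p^n (s≤s (s≤s z≤n)) n)

-- With z = ⌊x/M⌋ one has x < M(z + 1), so 4(xL + 1) ≤ 4LM(z + 1) ≤ 2^(t + z + 1).
polynomial≤2^ : ∀ L M t x .{{_ : NonZero L}} .{{_ : NonZero M}} → 4 * L * M ≤ 2 ^ t →
  (4 * suc (x * L)) ^ M ≤ 2 ^ (x + suc t * M)
polynomial≤2^ L M t x le = begin
  (4 * suc (x * L)) ^ M     ≤⟨ ^-monoˡ-≤ M base ⟩
  (2 ^ (t + z)) ^ M         ≡⟨ ^-*-assoc 2 (t + z) M ⟩
  2 ^ ((t + z) * M)         ≤⟨ ^-monoʳ-≤ 2 exponent ⟩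
  2 ^ (x + suc t * M)       ∎
  where
  open ≤-Reasoning
  z = suc (x / M)
  x<zM : suc x ≤ z * M
  x<zM = m<[1+m/n]*n x M
  base : 4 * suc (x * L) ≤ 2 ^ (t + z)
  base = begin
    4 * suc (x * L)      ≤⟨ *-monoʳ-≤ 4 (+-monoˡ-≤ (x * L) (>-nonZero⁻¹ L)) ⟩
    4 * (suc x * L)      ≤⟨ *-monoʳ-≤ 4 (*-monoˡ-≤ L x<zM) ⟩
    4 * (z * M * L)      ≡⟨ shuffle z M L ⟩
    4 * L * M * z        ≤⟨ *-mono-≤ le (n≤2^n z) ⟩
    2 ^ t * 2 ^ z        ≡⟨ ^-distribˡ-+-* 2 t z ⟨
    2 ^ (t + z)          ∎
    where
    shuffle : ∀ z M L → 4 * (z * M * L) ≡ 4 * L * M * z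
    shuffle = solve-∀
  exponent : (t + z) * M ≤ x + suc t * M
  exponent = begin
    (t + z) * M                  ≡⟨ shuffle t (x / M) M ⟩
    x / M * M + suc t * M        ≤⟨ +-monoˡ-≤ (suc t * M) (m/n*n≤m x M) ⟩
    x + suc t * M                ∎
    where
    shuffle : ∀ t z M → (t + suc z) * M ≡ z * M + suc t * M
    shuffle = solve-∀

-- Bounds for ψ

-- ψ(y) ≤ (p y + c) (log 2) / q and ψ(y) ≥ (p y − c) (log 2) / q.
record Upper (q p c : ℕ) : Set where
  constructor upper
  field bound : ∀ y → expψ y ^ q ≤ 2 ^ (p * y + c)

record Lower (q p c : ℕ) : Set where
  constructor lower
  field bound : ∀ y → 2 ^ (p * y) ≤ expψ y ^ q * 2 ^ c

upperSlopes lowerSlopes : ℕ → ℕ → List ℕ → ℕ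
upperSlopes p L ds = sum (map (λ d → suc (p * L ÷ d)) ds)
lowerSlopes p L ds = sum (map (λ d → p * L ÷ d) ds)

÷-upper : ∀ p x L d → p * (x * L ÷ d) ≤ x * suc (p * L ÷ d)
÷-upper p x L zero      = subst (_≤ x * 1) (sym (*-zeroʳ p)) z≤n
÷-upper p x L d@(suc _) = *-cancelʳ-≤ _ _ d (begin
  p * (x * L / d) * d          ≡⟨ *-assoc p (x * L / d) d ⟩
  p * (x * L / d * d)          ≤⟨ *-monoʳ-≤ p (m/n*n≤m (x * L) d) ⟩
  p * (x * L)                  ≡⟨ shuffle p x L ⟩
  x * (p * L)                  ≤⟨ *-monoʳ-≤ x (<⇒≤ (m<[1+m/n]*n (p * L) d)) ⟩
  x * (suc (p * L / d) * d)    ≡⟨ *-assoc x (suc (p * L / d)) d ⟨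
  x * suc (p * L / d) * d      ∎)
  where
  open ≤-Reasoning
  shuffle : ∀ p x L → p * (x * L) ≡ x * (p * L)
  shuffle = solve-∀

÷-lower : ∀ p x L d → x * (p * L ÷ d) ≤ p * (x * L ÷ d) + p
÷-lower p x L zero      = subst (_≤ p * 0 + p) (sym (*-zeroʳ x)) z≤n
÷-lower p x L d@(suc _) = *-cancelʳ-≤ _ _ d (begin
  x * (p * L / d) * d            ≡⟨ *-assoc x (p * L / d) d ⟩
  x * (p * L / d * d)            ≤⟨ *-monoʳ-≤ x (m/n*n≤m (p * L) d) ⟩
  x * (p * L)                    ≡⟨ shuffle p x L ⟩
  p * (x * L)                    ≤⟨ *-monoʳ-≤ p (<⇒≤ (m<[1+m/n]*n (x * L) d)) ⟩
  p * (suc (x * L / d) * d)      ≡⟨ shuffle₂ p (x * L / d) d ⟩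
  (p * (x * L / d) + p) * d      ∎)
  where
  open ≤-Reasoning
  shuffle : ∀ p x L → x * (p * L) ≡ p * (x * L)
  shuffle = solve-∀
  shuffle₂ : ∀ p z d → p * (suc z * d) ≡ (p * z + p) * d
  shuffle₂ = solve-∀

chebyshevs-upper : ∀ {q p c} → Upper q p c → ∀ x L ds →
  chebyshevs (x * L) ds ^ q ≤ 2 ^ (x * upperSlopes p L ds + length ds * c)
chebyshevs-upper {q} (upper up) x L [] rewrite *-zeroʳ x | ^-zeroˡ q = ≤-refl
chebyshevs-upper {q} {p} {c} u@(upper up) x L (d ∷ ds) = begin
  (expψ (x * L ÷ d) * chebyshevs (x * L) ds) ^ q
    ≡⟨ ^-distribʳ-* q (expψ (x * L ÷ d)) (chebyshevs (x * L) ds) ⟩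
  expψ (x * L ÷ d) ^ q * chebyshevs (x * L) ds ^ q
    ≤⟨ *-mono-≤ (up (x * L ÷ d)) (chebyshevs-upper u x L ds) ⟩
  2 ^ (p * (x * L ÷ d) + c) * 2 ^ (x * s + length ds * c)
    ≡⟨ ^-distribˡ-+-* 2 (p * (x * L ÷ d) + c) (x * s + length ds * c) ⟨
  2 ^ (p * (x * L ÷ d) + c + (x * s + length ds * c))
    ≤⟨ ^-monoʳ-≤ 2 (+-monoˡ-≤ (x * s + length ds * c) (+-monoˡ-≤ c (÷-upper p x L d))) ⟩
  2 ^ (x * suc (p * L ÷ d) + c + (x * s + length ds * c))
    ≡⟨ cong (2 ^_) (shuffle x (suc (p * L ÷ d)) c s (length ds)) ⟩
  2 ^ (x * (suc (p * L ÷ d) + s) + suc (length ds) * c) ∎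
  where
  open ≤-Reasoning
  s = upperSlopes p L ds
  shuffle : ∀ x a c s l → x * a + c + (x * s + l * c) ≡ x * (a + s) + suc l * c
  shuffle = solve-∀

chebyshevs-lower : ∀ {q p c} → Lower q p c → ∀ x L ds →
  2 ^ (x * lowerSlopes p L ds) ≤ chebyshevs (x * L) ds ^ q * 2 ^ (length ds * (c + p))
chebyshevs-lower {q} (lower lo) x L [] rewrite *-zeroʳ x | ^-zeroˡ q = ≤-refl
chebyshevs-lower {q} {p} {c} l@(lower lo) x L (d ∷ ds) = begin
  2 ^ (x * (p * L ÷ d + s))
    ≡⟨ ^-split 2 x (p * L ÷ d) s ⟩
  2 ^ (x * (p * L ÷ d)) * 2 ^ (x * s)
    ≤⟨ *-mono-≤ (^-monoʳ-≤ 2 (÷-lower p x L d)) (chebyshevs-lower l x L ds) ⟩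
  2 ^ (p * (x * L ÷ d) + p) * (C ^ q * 2 ^ (length ds * (c + p)))
    ≡⟨ cong (_* (C ^ q * 2 ^ (length ds * (c + p)))) (^-distribˡ-+-* 2 (p * (x * L ÷ d)) p) ⟩
  2 ^ (p * (x * L ÷ d)) * 2 ^ p * (C ^ q * 2 ^ (length ds * (c + p)))
    ≤⟨ *-monoˡ-≤ _ (*-monoˡ-≤ (2 ^ p) (lo (x * L ÷ d))) ⟩
  expψ (x * L ÷ d) ^ q * 2 ^ c * 2 ^ p * (C ^ q * 2 ^ (length ds * (c + p)))
    ≡⟨ shuffle (expψ (x * L ÷ d) ^ q) (2 ^ c) (2 ^ p) (C ^ q) (2 ^ (length ds * (c + p))) ⟩
  expψ (x * L ÷ d) ^ q * C ^ q * (2 ^ c * 2 ^ p * 2 ^ (length ds * (c + p)))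
    ≡⟨ cong₂ _*_ (^-distribʳ-* q (expψ (x * L ÷ d)) C)
         (trans (^-distribˡ-+-* 2 (c + p) (length ds * (c + p))) (cong (_* 2 ^ (length ds * (c + p))) (^-distribˡ-+-* 2 c p))) ⟨
  (expψ (x * L ÷ d) * C) ^ q * 2 ^ (suc (length ds) * (c + p)) ∎
  where
  open ≤-Reasoning
  s = lowerSlopes p L ds
  C = chebyshevs (x * L) ds
  shuffle : ∀ a b d e f → a * b * d * (e * f) ≡ a * e * (b * d * f)
  shuffle = solve-∀

-- From a quotient of factorials to new bounds for ψ

module FactorialQuotient
  (q₁ q₂ L t γ δ : ℕ) (P N : List ℕ)
  (balanced : Balanced L P N)
  {{_ : NonZero (q₁ * q₂)}} {{_ : NonZero L}} {{_ : NonZero (floors L N)}} {{_ : NonZero (length N)}}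
  (t-large : 4 * L * (length N * (q₁ * q₂)) ≤ 2 ^ t)
  -- The numerical check involves `q₂`-th powers only, which can still be computed. Raising it to
  -- the power `q₁` makes the rounding of slopes and the 3 in `factorials-growth` negligible.
  (growth : powerProduct L N ^ q₂ * 2 ^ γ ≤ powerProduct L P ^ q₂ * 2 ^ δ)
  where

  q : ℕ
  q = q₁ * q₂

  polyLoss : ℕ
  polyLoss = suc t * (length N * q)

  instance
    M≢0 : NonZero (length N * q)
    M≢0 = m*n≢0 (length N) q

  K≢0 : ∀ ds → NonZero (powerProduct L ds)
  K≢0 []       = _
  K≢0 (d ∷ ds) = m*n≢0 _ _ {{n^n≢0 (L ÷ d)}} {{K≢0 ds}}
    where
    n^n≢0 : ∀ n → NonZero (n ^ n)
    n^n≢0 zero    = _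
    n^n≢0 (suc n) = m^n≢0 (suc n) (suc n)

  growth-^ : ∀ x → (powerProduct L N ^ q) ^ x * 2 ^ (x * (γ * q₁)) ≤
                   (powerProduct L P ^ q) ^ x * 2 ^ (x * (δ * q₁))
  growth-^ x = subst₂ _≤_ (regroup (powerProduct L N) γ) (regroup (powerProduct L P) δ)
                 (^-monoˡ-≤ (q₁ * x) growth)
    where
    regroup : ∀ K γ → (K ^ q₂ * 2 ^ γ) ^ (q₁ * x) ≡ (K ^ q) ^ x * 2 ^ (x * (γ * q₁))
    regroup K γ = begin
      (K ^ q₂ * 2 ^ γ) ^ (q₁ * x)                  ≡⟨ ^-distribʳ-* (q₁ * x) (K ^ q₂) (2 ^ γ) ⟩
      (K ^ q₂) ^ (q₁ * x) * (2 ^ γ) ^ (q₁ * x)     ≡⟨ cong₂ _*_ (^-*-assoc K q₂ (q₁ * x)) (^-*-assoc 2 γ (q₁ * x)) ⟩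
      K ^ (q₂ * (q₁ * x)) * 2 ^ (γ * (q₁ * x))     ≡⟨ cong₂ (λ a b → K ^ a * 2 ^ b) (shuffle₁ q₂ q₁ x) (shuffle₂ γ q₁ x) ⟩
      K ^ (q * x) * 2 ^ (x * (γ * q₁))             ≡⟨ cong (_* 2 ^ (x * (γ * q₁))) (^-*-assoc K q x) ⟨
      (K ^ q) ^ x * 2 ^ (x * (γ * q₁))             ∎
      where
      open ≡-Reasoning
      shuffle₁ : ∀ a b x → a * (b * x) ≡ b * a * x
      shuffle₁ = solve-∀
      shuffle₂ : ∀ a b x → a * (b * x) ≡ x * (a * b)
      shuffle₂ = solve-∀

  -- The 3 collects 2^x from the polynomial factor and 4^x from the approximation of e.
  factorials-growth : ∀ x → factorials (x * L) N ^ q * 2 ^ (x * (γ * q₁)) ≤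
                            factorials (x * L) P ^ q * 2 ^ (x * (δ * q₁ + 3) + polyLoss)
  factorials-growth x = *-cancelʳ-≤ _ _ KP (begin
    FN * 2 ^ g * KP
      ≡⟨ shuffle₁ FN (2 ^ g) KP ⟩
    FN * KP * 2 ^ g
      ≤⟨ *-monoˡ-≤ (2 ^ g) (factorials-ratio-^ q L x P N (proj₁ balanced) (proj₁ (proj₂ balanced)) (proj₂ (proj₂ balanced))) ⟩
    E * KN * FP * 4 ^ x * 2 ^ g
      ≡⟨ shuffle₂ E KN FP (4 ^ x) (2 ^ g) ⟩
    E * (KN * 2 ^ g) * FP * 4 ^ x
      ≤⟨ *-monoˡ-≤ (4 ^ x) (*-monoˡ-≤ FP (*-mono-≤ (polynomial≤2^ L (length N * q) t x t-large) (growth-^ x))) ⟩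
    2 ^ (x + polyLoss) * (KP * 2 ^ d) * FP * 4 ^ x
      ≡⟨ shuffle₃ (2 ^ (x + polyLoss)) KP (2 ^ d) FP (4 ^ x) ⟩
    FP * (2 ^ (x + polyLoss) * 2 ^ d * 4 ^ x) * KP
      ≡⟨ cong (λ z → FP * z * KP) powers ⟩
    FP * 2 ^ (x * (δ * q₁ + 3) + polyLoss) * KP ∎)
    where
    open ≤-Reasoning
    FN = factorials (x * L) N ^ q
    FP = factorials (x * L) P ^ q
    KN = (powerProduct L N ^ q) ^ x
    KP = (powerProduct L P ^ q) ^ x
    E = (4 * suc (x * L)) ^ (length N * q)
    g = x * (γ * q₁)
    d = x * (δ * q₁)
    instance
      _ = m^n≢0 (powerProduct L P ^ q) x {{m^n≢0 (powerProduct L P) q {{K≢0 P}}}}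
    shuffle₁ : ∀ a b c → a * b * c ≡ a * c * b
    shuffle₁ = solve-∀
    shuffle₂ : ∀ a b c d e → a * b * c * d * e ≡ a * (b * e) * c * d
    shuffle₂ = solve-∀
    shuffle₃ : ∀ a b c d e → a * (b * c) * d * e ≡ d * (a * c * e) * b
    shuffle₃ = solve-∀
    shuffle₄ : ∀ x l e → x + l + x * e + 2 * x ≡ x * (e + 3) + l
    shuffle₄ = solve-∀
    powers : 2 ^ (x + polyLoss) * 2 ^ d * 4 ^ x ≡ 2 ^ (x * (δ * q₁ + 3) + polyLoss)
    powers = begin-equality
      2 ^ (x + polyLoss) * 2 ^ d * 4 ^ x         ≡⟨ cong₂ _*_ (sym (^-distribˡ-+-* 2 (x + polyLoss) d)) (^-*-assoc 2 2 x) ⟩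
      2 ^ (x + polyLoss + d) * 2 ^ (2 * x)       ≡⟨ ^-distribˡ-+-* 2 (x + polyLoss + d) (2 * x) ⟨
      2 ^ (x + polyLoss + d + 2 * x)             ≡⟨ cong (2 ^_) (shuffle₄ x polyLoss (δ * q₁)) ⟩
      2 ^ (x * (δ * q₁ + 3) + polyLoss)          ∎

  module _ {pᵤ cᵤ pₗ cₗ} (up : Upper q pᵤ cᵤ) (lo : Lower q pₗ cₗ) (A B : List ℕ) where

    loss : ℕ
    loss = length B * cᵤ + length A * (cₗ + pₗ) + polyLoss

    gain cost : ℕ
    gain = lowerSlopes pₗ L A + γ * q₁
    cost = upperSlopes pᵤ L B + (δ * q₁ + 3)

    -- `V` and `W` keep a place for `expψ (x * L)`, the term to be bounded: `newUpper` puts it at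
    -- `V`, `newLower` at `W`, with 1 at the other. The remaining ψ terms are estimated by `lo` on
    -- the left and by `up` on the right.
    exchange : ∀ x V W →
      factorials (x * L) P * (V * chebyshevs (x * L) A) ≤ factorials (x * L) N * (W * chebyshevs (x * L) B) →
      V ^ q * 2 ^ (x * gain) ≤ W ^ q * 2 ^ (x * cost + loss)
    exchange x V W le = *-cancelʳ-≤ _ _ FP (begin
      V ^ q * 2 ^ (x * gain) * FP
        ≡⟨ cong (λ z → V ^ q * z * FP) (^-split 2 x sₗ (γ * q₁)) ⟩
      V ^ q * (2 ^ (x * sₗ) * 2 ^ g) * FP
        ≤⟨ *-monoˡ-≤ FP (*-monoʳ-≤ (V ^ q) (*-monoˡ-≤ (2 ^ g) (chebyshevs-lower lo x L A))) ⟩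
      V ^ q * (CA ^ q * 2 ^ a * 2 ^ g) * FP
        ≡⟨ shuffle₁ (V ^ q) (CA ^ q) (2 ^ a) (2 ^ g) FP ⟩
      FP * (V ^ q * CA ^ q) * (2 ^ a * 2 ^ g)
        ≡⟨ cong (_* (2 ^ a * 2 ^ g)) (distrib (factorials (x * L) P) V CA) ⟨
      (factorials (x * L) P * (V * CA)) ^ q * (2 ^ a * 2 ^ g)
        ≤⟨ *-monoˡ-≤ (2 ^ a * 2 ^ g) (^-monoˡ-≤ q le) ⟩
      (factorials (x * L) N * (W * CB)) ^ q * (2 ^ a * 2 ^ g)
        ≡⟨ cong (_* (2 ^ a * 2 ^ g)) (distrib (factorials (x * L) N) W CB) ⟩
      FN * (W ^ q * CB ^ q) * (2 ^ a * 2 ^ g)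
        ≡⟨ shuffle₂ FN (W ^ q) (CB ^ q) (2 ^ a) (2 ^ g) ⟩
      W ^ q * (FN * 2 ^ g) * (CB ^ q * 2 ^ a)
        ≤⟨ *-mono-≤ (*-monoʳ-≤ (W ^ q) (factorials-growth x)) (*-monoˡ-≤ (2 ^ a) (chebyshevs-upper up x L B)) ⟩
      W ^ q * (FP * 2 ^ (x * (δ * q₁ + 3) + polyLoss)) * (2 ^ (x * sᵤ + length B * cᵤ) * 2 ^ a)
        ≡⟨ shuffle₃ (W ^ q) FP (2 ^ (x * (δ * q₁ + 3) + polyLoss)) (2 ^ (x * sᵤ + length B * cᵤ)) (2 ^ a) ⟩
      W ^ q * (2 ^ (x * (δ * q₁ + 3) + polyLoss) * 2 ^ (x * sᵤ + length B * cᵤ) * 2 ^ a) * FP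
        ≡⟨ cong (λ z → W ^ q * z * FP) powers ⟩
      W ^ q * 2 ^ (x * cost + loss) * FP ∎)
      where
      open ≤-Reasoning
      FN = factorials (x * L) N ^ q
      FP = factorials (x * L) P ^ q
      CA = chebyshevs (x * L) A
      CB = chebyshevs (x * L) B
      sₗ = lowerSlopes pₗ L A
      sᵤ = upperSlopes pᵤ L B
      g = x * (γ * q₁)
      a = length A * (cₗ + pₗ)
      factorials≢0 : ∀ ds → NonZero (factorials (x * L) ds)
      factorials≢0 []       = _
      factorials≢0 (d ∷ ds) = m*n≢0 _ _ {{(x * L ÷ d) !≢0}} {{factorials≢0 ds}}
      instance
        _ = m^n≢0 (factorials (x * L) P) q {{factorials≢0 P}}
      distrib : ∀ a b c → (a * (b * c)) ^ q ≡ a ^ q * (b ^ q * c ^ q)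
      distrib a b c = trans (^-distribʳ-* q a (b * c)) (cong (a ^ q *_) (^-distribʳ-* q b c))
      shuffle₁ : ∀ v c a g f → v * (c * a * g) * f ≡ f * (v * c) * (a * g)
      shuffle₁ = solve-∀
      shuffle₂ : ∀ f w c a g → f * (w * c) * (a * g) ≡ w * (f * g) * (c * a)
      shuffle₂ = solve-∀
      shuffle₃ : ∀ w f u v a → w * (f * u) * (v * a) ≡ w * (u * v * a) * f
      shuffle₃ = solve-∀
      shuffle₄ : ∀ x d l s b a → x * d + l + (x * s + b) + a ≡ x * (s + d) + (b + a + l)
      shuffle₄ = solve-∀
      powers : 2 ^ (x * (δ * q₁ + 3) + polyLoss) * 2 ^ (x * sᵤ + length B * cᵤ) * 2 ^ a ≡ 2 ^ (x * cost + loss)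
      powers = begin-equality
        2 ^ u * 2 ^ v * 2 ^ a    ≡⟨ cong (_* 2 ^ a) (^-distribˡ-+-* 2 u v) ⟨
        2 ^ (u + v) * 2 ^ a      ≡⟨ ^-distribˡ-+-* 2 (u + v) a ⟨
        2 ^ (u + v + a)          ≡⟨ cong (2 ^_) (shuffle₄ x (δ * q₁ + 3) polyLoss sᵤ (length B * cᵤ) a) ⟩
        2 ^ (x * cost + loss)    ∎
        where
        u = x * (δ * q₁ + 3) + polyLoss
        v = x * sᵤ + length B * cᵤ

    ÷1 : ∀ x → expψ (x * L) ≡ expψ (x * L ÷ 1)
    ÷1 x = cong expψ (sym (n/1≡n (x * L)))

    -- The bound is proved at multiples of `L`, where `slope` compares the coefficients of x.
    -- Rounding `y` up to the next multiple costs the constant `p * L`.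
    newUpper : ∀ p → Dominated P (1 ∷ A) N B → cost ≤ p * L + gain → Upper q p (p * L + loss)
    newUpper p dom slope = upper λ y → let x = suc (y / L) in begin
      expψ y ^ q                   ≤⟨ ^-monoˡ-≤ q (expψ-mono (<⇒≤ (m<[1+m/n]*n y L))) ⟩
      expψ (x * L) ^ q             ≤⟨ main x ⟩
      2 ^ (x * (p * L) + loss)     ≤⟨ ^-monoʳ-≤ 2 (round y) ⟩
      2 ^ (p * y + (p * L + loss)) ∎
      where
      open ≤-Reasoning
      main : ∀ x → expψ (x * L) ^ q ≤ 2 ^ (x * (p * L) + loss)
      main x = *-cancelʳ-≤ _ _ (2 ^ (x * gain)) {{m^n≢0 2 (x * gain)}} (begin
        expψ (x * L) ^ q * 2 ^ (x * gain)
          ≤⟨ exchange x (expψ (x * L)) 1 (subst₂ (λ u v → factorials (x * L) P * (u * chebyshevs (x * L) A) ≤ factorials (x * L) N * v)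
               (sym (÷1 x)) (sym (*-identityˡ _)) (dominated⇒≤ {P} {1 ∷ A} {N} {B} dom (x * L))) ⟩
        1 ^ q * 2 ^ (x * cost + loss)
          ≡⟨ trans (cong (_* 2 ^ (x * cost + loss)) (^-zeroˡ q)) (*-identityˡ _) ⟩
        2 ^ (x * cost + loss)
          ≤⟨ ^-monoʳ-≤ 2 (+-monoˡ-≤ loss (*-monoʳ-≤ x slope)) ⟩
        2 ^ (x * (p * L + gain) + loss)
          ≡⟨ cong (2 ^_) (shuffle x (p * L) gain loss) ⟩
        2 ^ (x * (p * L) + loss + x * gain)
          ≡⟨ ^-distribˡ-+-* 2 (x * (p * L) + loss) (x * gain) ⟩
        2 ^ (x * (p * L) + loss) * 2 ^ (x * gain) ∎)
        where
        shuffle : ∀ x a b l → x * (a + b) + l ≡ x * a + l + x * b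
        shuffle = solve-∀
      round : ∀ y → suc (y / L) * (p * L) + loss ≤ p * y + (p * L + loss)
      round y = begin
        suc (y / L) * (p * L) + loss       ≡⟨ shuffle (y / L) p L loss ⟩
        p * (y / L * L) + (p * L + loss)   ≤⟨ +-monoˡ-≤ (p * L + loss) (*-monoʳ-≤ p (m/n*n≤m y L)) ⟩
        p * y + (p * L + loss)             ∎
        where
        shuffle : ∀ z p L l → suc z * (p * L) + l ≡ p * (z * L) + (p * L + l)
        shuffle = solve-∀

    -- As for `newUpper`, but `y` is rounded down to a multiple of `L`.
    newLower : ∀ p → Dominated P A N (1 ∷ B) → p * L + cost ≤ gain → Lower q p (p * L + loss)
    newLower p dom slope = lower λ y → let x = y / L in begin
      2 ^ (p * y)                                ≤⟨ ^-monoʳ-≤ 2 (round y) ⟩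
      2 ^ (x * (p * L) + p * L)                  ≡⟨ ^-distribˡ-+-* 2 (x * (p * L)) (p * L) ⟩
      2 ^ (x * (p * L)) * 2 ^ (p * L)            ≤⟨ *-monoˡ-≤ (2 ^ (p * L)) (main x) ⟩
      expψ (x * L) ^ q * 2 ^ loss * 2 ^ (p * L)  ≤⟨ *-monoˡ-≤ (2 ^ (p * L)) (*-monoˡ-≤ (2 ^ loss) (^-monoˡ-≤ q (expψ-mono (m/n*n≤m y L)))) ⟩
      expψ y ^ q * 2 ^ loss * 2 ^ (p * L)        ≡⟨ *-assoc (expψ y ^ q) (2 ^ loss) (2 ^ (p * L)) ⟩
      expψ y ^ q * (2 ^ loss * 2 ^ (p * L))      ≡⟨ cong (expψ y ^ q *_) (trans (*-comm (2 ^ loss) (2 ^ (p * L))) (sym (^-distribˡ-+-* 2 (p * L) loss))) ⟩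
      expψ y ^ q * 2 ^ (p * L + loss)            ∎
      where
      open ≤-Reasoning
      main : ∀ x → 2 ^ (x * (p * L)) ≤ expψ (x * L) ^ q * 2 ^ loss
      main x = *-cancelʳ-≤ _ _ (2 ^ (x * cost)) {{m^n≢0 2 (x * cost)}} (begin
        2 ^ (x * (p * L)) * 2 ^ (x * cost)           ≡⟨ ^-split 2 x (p * L) cost ⟨
        2 ^ (x * (p * L + cost))                     ≤⟨ ^-monoʳ-≤ 2 (*-monoʳ-≤ x slope) ⟩
        2 ^ (x * gain)                               ≡⟨ trans (cong (_* 2 ^ (x * gain)) (^-zeroˡ q)) (*-identityˡ _) ⟨
        1 ^ q * 2 ^ (x * gain)
          ≤⟨ exchange x 1 (expψ (x * L)) (subst₂ (λ u v → factorials (x * L) P * v ≤ factorials (x * L) N * (u * chebyshevs (x * L) B))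
               (sym (÷1 x)) (sym (*-identityˡ _)) (dominated⇒≤ {P} {A} {N} {1 ∷ B} dom (x * L))) ⟩
        expψ (x * L) ^ q * 2 ^ (x * cost + loss)     ≡⟨ cong (expψ (x * L) ^ q *_) (trans (^-distribˡ-+-* 2 (x * cost) loss) (*-comm (2 ^ (x * cost)) (2 ^ loss))) ⟩
        expψ (x * L) ^ q * (2 ^ loss * 2 ^ (x * cost))  ≡⟨ *-assoc (expψ (x * L) ^ q) (2 ^ loss) (2 ^ (x * cost)) ⟨
        expψ (x * L) ^ q * 2 ^ loss * 2 ^ (x * cost) ∎)
      round : ∀ y → p * y ≤ y / L * (p * L) + p * L
      round y = begin
        p * y                          ≤⟨ *-monoʳ-≤ p (<⇒≤ (m<[1+m/n]*n y L)) ⟩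
        p * (suc (y / L) * L)          ≡⟨ shuffle p (y / L) L ⟩
        y / L * (p * L) + p * L        ∎
        where
        shuffle : ∀ p z L → p * (suc z * L) ≡ z * (p * L) + p * L
        shuffle = solve-∀

-- A first linear bound for ψ

[2m]!≤4^m*m!² : ∀ m → (m * 2) ! ≤ 4 ^ m * (m ! * (m ! * 1))
[2m]!≤4^m*m!² zero    = ≤-refl
[2m]!≤4^m*m!² (suc m) = begin
  suc (suc (m * 2)) * (suc (m * 2) * (m * 2) !)
    ≤⟨ *-monoʳ-≤ (suc (suc (m * 2))) (*-monoˡ-≤ ((m * 2) !) (n≤1+n (suc (m * 2)))) ⟩
  suc (suc (m * 2)) * (suc (suc (m * 2)) * (m * 2) !)
    ≤⟨ *-monoʳ-≤ (suc (suc (m * 2))) (*-monoʳ-≤ (suc (suc (m * 2))) ([2m]!≤4^m*m!² m)) ⟩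
  suc (suc (m * 2)) * (suc (suc (m * 2)) * (4 ^ m * (m ! * (m ! * 1))))
    ≡⟨ shuffle m (4 ^ m) (m !) ⟩
  4 * 4 ^ m * (suc m * m ! * (suc m * m ! * 1)) ∎
  where
  open ≤-Reasoning
  shuffle : ∀ m p f → suc (suc (m * 2)) * (suc (suc (m * 2)) * (p * (f * (f * 1)))) ≡ 4 * p * (suc m * f * (suc m * f * 1))
  shuffle = solve-∀

-- The quotient x!/⌊x/2⌋!² at x = 2m: ψ(2m) - ψ(m) is at most the logarithm of the central binomial
-- coefficient. The factors `* 1` come from unfolding `factorials`.
expψ-double : ∀ m → expψ (m * 2) ≤ 4 ^ m * expψ m
expψ-double m = *-cancelˡ-≤ (m ! * (m ! * 1)) {{m*n≢0 (m !) (m ! * 1) {{m !≢0}} {{m*n≢0 (m !) 1 {{m !≢0}}}}}} (begin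
  m ! * (m ! * 1) * expψ (m * 2)
    ≡⟨ cong₂ (λ a b → a ! * (a ! * 1) * expψ b) (m*n/n≡m m 2) (n/1≡n (m * 2)) ⟨
  (m * 2 / 2) ! * ((m * 2 / 2) ! * 1) * expψ (m * 2 / 1)
    ≡⟨ cong ((m * 2 / 2) ! * ((m * 2 / 2) ! * 1) *_) (*-identityʳ _) ⟨
  factorials (m * 2) (2 ∷ 2 ∷ []) * chebyshevs (m * 2) (1 ∷ [])
    ≤⟨ dominated⇒≤ {2 ∷ 2 ∷ []} {1 ∷ []} {1 ∷ []} {2 ∷ []} dom (m * 2) ⟩
  factorials (m * 2) (1 ∷ []) * chebyshevs (m * 2) (2 ∷ [])
    ≡⟨ cong₂ _*_ (*-identityʳ ((m * 2 / 1) !)) (*-identityʳ (expψ (m * 2 / 2))) ⟩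
  (m * 2 / 1) ! * expψ (m * 2 / 2)
    ≡⟨ cong₂ (λ a b → a ! * expψ b) (n/1≡n (m * 2)) (m*n/n≡m m 2) ⟩
  (m * 2) ! * expψ m
    ≤⟨ *-monoˡ-≤ (expψ m) ([2m]!≤4^m*m!² m) ⟩
  4 ^ m * (m ! * (m ! * 1)) * expψ m
    ≡⟨ shuffle (4 ^ m) (m ! * (m ! * 1)) (expψ m) ⟩
  m ! * (m ! * 1) * (4 ^ m * expψ m) ∎)
  where
  open ≤-Reasoning
  shuffle : ∀ a b c → a * b * c ≡ b * (a * c)
  shuffle = solve-∀
  dom : Dominated (2 ∷ 2 ∷ []) (1 ∷ []) (1 ∷ []) (2 ∷ [])
  dom = dominated-check 2 2 (2 ∷ 2 ∷ []) (1 ∷ []) (1 ∷ []) (2 ∷ []) _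

-- Doubling from h = ⌈n/2⌉ gives the exponent 2h + 5h ≤ 5n. The constant may be crude, since each
-- Chebyshev round divides its influence by 6.
expψ≤2^5n : ∀ n → expψ n ≤ 2 ^ (5 * n)
expψ≤2^5n = <-rec _ step
  where
  open ≤-Reasoning
  step : ∀ n → (∀ {m} → m < n → expψ m ≤ 2 ^ (5 * m)) → expψ n ≤ 2 ^ (5 * n)
  step zero          rec = ≤-refl
  step (suc zero)    rec = ≤-trans (≤-reflexive (trans (*-identityˡ (expΛ 1)) expΛ[1]≡1)) (s≤s z≤n)
  step (suc (suc n)) rec = begin
    expψ (suc (suc n))         ≤⟨ expψ-mono le ⟩
    expψ (h * 2)               ≤⟨ expψ-double h ⟩
    4 ^ h * expψ h             ≤⟨ *-monoʳ-≤ (4 ^ h) (rec h<) ⟩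
    4 ^ h * 2 ^ (5 * h)        ≡⟨ cong (_* 2 ^ (5 * h)) (^-*-assoc 2 2 h) ⟩
    2 ^ (2 * h) * 2 ^ (5 * h)  ≡⟨ ^-distribˡ-+-* 2 (2 * h) (5 * h) ⟨
    2 ^ (2 * h + 5 * h)        ≤⟨ ^-monoʳ-≤ 2 exponent ⟩
    2 ^ (5 * suc (suc n))      ∎
    where
    z = suc n / 2
    h = suc z
    z*2≤ : z * 2 ≤ suc n
    z*2≤ = m/n*n≤m (suc n) 2
    le : suc (suc n) ≤ h * 2
    le = m<[1+m/n]*n (suc n) 2
    h< : h < suc (suc n)
    h< = s≤s (m/n<m (suc n) 2 (s≤s (s≤s z≤n)))
    exponent : 2 * h + 5 * h ≤ 5 * suc (suc n)
    exponent = begin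
      2 * suc z + 5 * suc z     ≡⟨ shuffle₁ z ⟩
      3 * (z * 2) + z + 7       ≤⟨ +-monoˡ-≤ 7 (+-mono-≤ (*-monoʳ-≤ 3 z*2≤) (s≤s⁻¹ (s≤s⁻¹ h<))) ⟩
      3 * suc n + n + 7         ≤⟨ m≤m+n _ n ⟩
      3 * suc n + n + 7 + n     ≡⟨ shuffle₂ n ⟩
      5 * suc (suc n)           ∎
      where
      shuffle₁ : ∀ z → 2 * suc z + 5 * suc z ≡ 3 * (z * 2) + z + 7
      shuffle₁ = solve-∀
      shuffle₂ : ∀ n → 3 * suc n + n + 7 + n ≡ 5 * suc (suc n)
      shuffle₂ = solve-∀

upperBase : ∀ q → Upper q (5 * q) 0
upperBase q = upper λ y → begin
  expψ y ^ q              ≤⟨ ^-monoˡ-≤ q (expψ≤2^5n y) ⟩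
  (2 ^ (5 * y)) ^ q       ≡⟨ ^-*-assoc 2 (5 * y) q ⟩
  2 ^ (5 * y * q)         ≡⟨ cong (2 ^_) (shuffle y q) ⟩
  2 ^ (5 * q * y + 0)     ∎
  where
  open ≤-Reasoning
  shuffle : ∀ y q → 5 * y * q ≡ 5 * q * y + 0
  shuffle = solve-∀

lowerBase : ∀ q → Lower q 0 0
lowerBase q = lower λ y → *-mono-≤ (m^n>0 (expψ y) {{>-nonZero (expψ≥1 y)}} q) (≤-refl {1})

-- The quotient ∏ ⌊x/n⌋! / ∏ ⌊x/d⌋! over numerators n and denominators d. The first
-- pair is Chebyshev's x! ⌊x/30⌋! / ⌊x/2⌋! ⌊x/3⌋! ⌊x/5⌋!; the other two come from
-- linear programming. Iterating them in the manner of Sylvester narrows ψ(x)/x from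
-- [0.9212, 1.1074] to [0.9417, 1.0554], and 1.0554/0.9417 < 9/8.
chebyshevNumerators chebyshevDenominators : List ℕ
chebyshevNumerators = 1 ∷ 30 ∷ []
chebyshevDenominators = 2 ∷ 3 ∷ 5 ∷ []

lowerNumerators lowerDenominators : List ℕ
lowerNumerators = 1 ∷ 6 ∷ 14 ∷ 84 ∷ 140 ∷ 840 ∷ []
lowerDenominators = 2 ∷ 3 ∷ 5 ∷ 7 ∷ 28 ∷ 42 ∷ 70 ∷ 168 ∷ 420 ∷ []

upperNumerators upperDenominators : List ℕ
upperNumerators = 1 ∷ 6 ∷ 10 ∷ 28 ∷ 60 ∷ []
upperDenominators = 2 ∷ 3 ∷ 5 ∷ 7 ∷ 20 ∷ 24 ∷ 30 ∷ 56 ∷ []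

-- All bounds use the unit q = 1000 · 100, and 840 is a common multiple of all entries.
-- Of γ and δ one is 0 and the other 100 log₂ (∏ (840/n)^(840/n) / ∏ (840/d)^(840/d)),
-- rounded in the safe direction.
upper₀ : Upper 100000 500000 0
upper₀ = upperBase 100000

lower₀ : Lower 100000 0 0
lower₀ = lowerBase 100000

module Chebyshev⁻ = FactorialQuotient 1000 100 840 30 0 111649 chebyshevDenominators chebyshevNumerators
  (toWitness {a? = balanced? 840 chebyshevDenominators chebyshevNumerators} _)
  (≤ᵇ⇒≤ _ _ _) (≤ᵇ⇒≤ _ _ _)

-- Chebyshev's ψ(x) - ψ(x/6) ≤ T(x), where T is the logarithm of his quotient.
chebyshev⁻ : Dominated chebyshevDenominators (1 ∷ []) chebyshevNumerators (6 ∷ [])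
chebyshev⁻ = dominated-check 840 6 chebyshevDenominators (1 ∷ []) chebyshevNumerators (6 ∷ []) _

-- A round sends the slope p to about p/6 + 132915, with fixed point near 159500; the fourth round
-- comes close to it.
upper₁ : Upper 100000 216249 187849160
upper₁ = Chebyshev⁻.newUpper upper₀ lower₀ [] (6 ∷ []) 216249 chebyshev⁻ (≤ᵇ⇒≤ _ _ _)

upper₂ : Upper 100000 168957 335973040
upper₂ = Chebyshev⁻.newUpper upper₁ lower₀ [] (6 ∷ []) 168957 chebyshev⁻ (≤ᵇ⇒≤ _ _ _)

upper₃ : Upper 100000 161075 477476040
upper₃ = Chebyshev⁻.newUpper upper₂ lower₀ [] (6 ∷ []) 161075 chebyshev⁻ (≤ᵇ⇒≤ _ _ _)

upper₄ : Upper 100000 159762 617876120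
upper₄ = Chebyshev⁻.newUpper upper₃ lower₀ [] (6 ∷ []) 159762 chebyshev⁻ (≤ᵇ⇒≤ _ _ _)

module Chebyshev⁺ = FactorialQuotient 1000 100 840 30 111648 0 chebyshevNumerators chebyshevDenominators
  (toWitness {a? = balanced? 840 chebyshevNumerators chebyshevDenominators} _)
  (≤ᵇ⇒≤ _ _ _) (≤ᵇ⇒≤ _ _ _)

-- Chebyshev's companion inequality T(x) ≤ ψ(x).
chebyshev⁺ : Dominated chebyshevNumerators [] chebyshevDenominators (1 ∷ [])
chebyshev⁺ = dominated-check 840 1 chebyshevNumerators [] chebyshevDenominators (1 ∷ []) _

lower₁ : Lower 100000 132914 120947760
lower₁ = Chebyshev⁺.newLower upper₄ lower₀ [] [] 132914 chebyshev⁺ (≤ᵇ⇒≤ _ _ _)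

module Refined⁺ = FactorialQuotient 1000 100 840 32 126401 0 lowerNumerators lowerDenominators
  (toWitness {a? = balanced? 840 lowerNumerators lowerDenominators} _)
  (≤ᵇ⇒≤ _ _ _) (≤ᵇ⇒≤ _ _ _)

-- The 102 is the largest divisor among the ψ terms; from there on all jumps have occurred.
refined⁺ : Dominated lowerNumerators (20 ∷ []) lowerDenominators (1 ∷ 13 ∷ 19 ∷ 102 ∷ [])
refined⁺ = dominated-check 840 102 lowerNumerators (20 ∷ []) lowerDenominators (1 ∷ 13 ∷ 19 ∷ 102 ∷ []) _

lower₂ : Lower 100000 134858 2117689754
lower₂ = Refined⁺.newLower upper₄ lower₁ (20 ∷ []) (13 ∷ 19 ∷ 102 ∷ []) 134858 refined⁺ (≤ᵇ⇒≤ _ _ _)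

module Refined⁻ = FactorialQuotient 1000 100 840 31 0 128941 upperDenominators upperNumerators
  (toWitness {a? = balanced? 840 upperDenominators upperNumerators} _)
  (≤ᵇ⇒≤ _ _ _) (≤ᵇ⇒≤ _ _ _)

refined⁻ : Dominated upperDenominators (1 ∷ 11 ∷ 17 ∷ []) upperNumerators (15 ∷ 21 ∷ 97 ∷ [])
refined⁻ = dominated-check 840 97 upperDenominators (1 ∷ 11 ∷ 17 ∷ []) upperNumerators (15 ∷ 21 ∷ 97 ∷ []) _

-- With ψ terms on both sides, a new bound uses the latest lower and the latest upper one, so the
-- two are improved in turn. At the end 8 · 152248 < 9 · 135868.
upper₅ : Upper 100000 153215 6233978184
upper₅ = Refined⁻.newUpper upper₄ lower₂ (11 ∷ 17 ∷ []) (15 ∷ 21 ∷ 97 ∷ []) 153215 refined⁻ (≤ᵇ⇒≤ _ _ _)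

lower₃ : Lower 100000 135868 20963588284
lower₃ = Refined⁺.newLower upper₅ lower₂ (20 ∷ []) (13 ∷ 19 ∷ 102 ∷ []) 135868 refined⁺ (≤ᵇ⇒≤ _ _ _)

upper₆ : Upper 100000 152248 60773271176
upper₆ = Refined⁻.newUpper upper₅ lower₃ (11 ∷ 17 ∷ []) (15 ∷ 21 ∷ 97 ∷ []) 152248 refined⁻ (≤ᵇ⇒≤ _ _ _)

-- Primes between n/3 and 3n/8

-- Boolean tests let the long list of primes be checked by fast arithmetic. The trial divisor
-- `2 + e` is visibly nonzero; running out of fuel gives `false`, which is harmless because only
-- soundness matters.
trialDivision : ℕ → ℕ → ℕ → Bool
trialDivision zero       e p = false
trialDivision (suc fuel) e p =
  if p <ᵇ (2 + e) * (2 + e) then true else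
  if p % (2 + e) ≡ᵇ 0 then false else trialDivision fuel (suc e) p

trialDivision-sound : ∀ fuel e p .{{_ : NonTrivial p}} →
  (2 + e) Rough p → T (trialDivision fuel e p) → Prime p
trialDivision-sound (suc fuel) e p rough t with p <ᵇ (2 + e) * (2 + e) in small
... | true = rough∧square>⇒prime rough (<ᵇ⇒< p _ (subst T (sym small) _))
... | false with p % (2 + e) ≡ᵇ 0 in divisible
...   | false = trialDivision-sound fuel (suc e) p
        (∤⇒rough-suc (λ d∣p → subst T divisible (≡⇒≡ᵇ _ _ (n∣m⇒m%n≡0 p (2 + e) d∣p))) rough) t

isPrime : ℕ → Bool
isPrime p = (1 <ᵇ p) ∧ trialDivision p 0 p

isPrime-sound : ∀ p → T (isPrime p) → Prime p
isPrime-sound p@(suc (suc _)) t = trialDivision-sound p 0 p 2-rough t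

WitnessPrime : ℕ → ℕ → Set
WitnessPrime n p = Prime p × n < 3 * p × 8 * p ≤ suc (3 * n)

-- The prime p serves all n with (8p - 1)/3 ≤ n < 3p; these ranges have to overlap.
chain : ℕ → ℕ → List ℕ → Bool
chain lo hi []       = hi ≤ᵇ lo
chain lo hi (p ∷ ps) = isPrime p ∧ (8 * p ≤ᵇ suc (3 * lo)) ∧ chain (3 * p) hi ps

T-∧ˡ : ∀ {a b} → T (a ∧ b) → T a
T-∧ˡ {true} _ = _

T-∧ʳ : ∀ {a b} → T (a ∧ b) → T b
T-∧ʳ {true} t = t

chain-sound : ∀ lo hi ps → T (chain lo hi ps) → ∀ n → lo ≤ n → n < hi → ∃ (WitnessPrime n)
chain-sound lo hi []       t n lo≤n n<hi = contradiction (≤-trans (≤ᵇ⇒≤ hi lo t) lo≤n) (<⇒≱ n<hi)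
chain-sound lo hi (p ∷ ps) t n lo≤n n<hi with n <? 3 * p
... | yes n<3p = p , isPrime-sound p (T-∧ˡ t) , n<3p ,
        ≤-trans (≤ᵇ⇒≤ (8 * p) (suc (3 * lo)) (T-∧ˡ (T-∧ʳ {isPrime p} t))) (s≤s (*-monoʳ-≤ 3 lo≤n))
... | no n≮3p = chain-sound (3 * p) hi ps (T-∧ʳ {8 * p ≤ᵇ suc (3 * lo)} (T-∧ʳ {isPrime p} t)) n (≮⇒≥ n≮3p) n<hi

sqrt : ∀ n → ∃ λ s → s * s ≤ n × n < suc s * suc s
sqrt zero    = 0 , z≤n , s≤s z≤n
sqrt (suc n) with sqrt n
... | s , s²≤n , n<s′² with suc n <? suc s * suc s
...   | yes 1+n< = s , m≤n⇒m≤1+n s²≤n , 1+n<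
...   | no 1+n≮ = suc s , ≮⇒≥ 1+n≮ , ≤-<-trans n<s′² (*-mono-< (n<1+n (suc s)) (n<1+n (suc s)))

-- Trades √b for b/t + t, so that every term of `noGap` is linear in `b`. A product of two numbers
-- is at most the square of the larger.
sqrt-linear : ∀ {s b} t → s * s ≤ b → t * s ≤ b + t * t
sqrt-linear {s} {b} t s²≤b with ≤-total t s
... | inj₁ t≤s = ≤-trans (*-monoˡ-≤ s t≤s) (≤-trans s²≤b (m≤m+n b (t * t)))
... | inj₂ s≤t = ≤-trans (*-monoʳ-≤ t s≤t) (m≤n+m (t * t) b)

-- Without primes in (n/3, 3n/8] the bounds at b = ⌊3n/8⌋ and a = ⌊n/3⌋ give
-- l b ≤ u a + u √b + O(1), which fails for large b because 9 l > 8 u.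
module LargeRange {q u cᵤ l cₗ} (up : Upper q u cᵤ) (lo : Lower q l cₗ)
  -- `y` is the surplus of 9tl over 8tu, less the 9u paid for `sqrt-linear`.
  (t y b₀ : ℕ) (split : t * (8 * u) + 9 * u + y ≡ 9 * t * l)
  (large : t * u * 7 + 9 * u * (t * t) + 9 * t * (2 * cᵤ + cₗ) < y * b₀) where

  open Upper up renaming (bound to upper-bound)
  open Lower lo renaming (bound to lower-bound)

  exponents : ∀ {a b s} → expψ b ≤ expψ a * expψ s → l * b ≤ u * a + u * s + (2 * cᵤ + cₗ)
  exponents {a} {b} {s} le with l * b ≤? u * a + u * s + (2 * cᵤ + cₗ)
  ... | yes h = h
  ... | no ¬h = contradiction (begin
      2 ^ (l * b)
        ≤⟨ lower-bound b ⟩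
      expψ b ^ q * 2 ^ cₗ
        ≤⟨ *-monoˡ-≤ (2 ^ cₗ) (^-monoˡ-≤ q le) ⟩
      (expψ a * expψ s) ^ q * 2 ^ cₗ
        ≡⟨ cong (_* 2 ^ cₗ) (^-distribʳ-* q (expψ a) (expψ s)) ⟩
      expψ a ^ q * expψ s ^ q * 2 ^ cₗ
        ≤⟨ *-monoˡ-≤ (2 ^ cₗ) (*-mono-≤ (upper-bound a) (upper-bound s)) ⟩
      2 ^ (u * a + cᵤ) * 2 ^ (u * s + cᵤ) * 2 ^ cₗ
        ≡⟨ cong (_* 2 ^ cₗ) (^-distribˡ-+-* 2 (u * a + cᵤ) (u * s + cᵤ)) ⟨
      2 ^ (u * a + cᵤ + (u * s + cᵤ)) * 2 ^ cₗ
        ≡⟨ ^-distribˡ-+-* 2 (u * a + cᵤ + (u * s + cᵤ)) cₗ ⟨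
      2 ^ (u * a + cᵤ + (u * s + cᵤ) + cₗ)
        ≡⟨ cong (2 ^_) (shuffle (u * a) (u * s) cᵤ cₗ) ⟩
      2 ^ (u * a + u * s + (2 * cᵤ + cₗ)) ∎)
      (<⇒≱ (^-monoʳ-< 2 (s≤s (s≤s z≤n)) (≰⇒> ¬h)))
    where
    open ≤-Reasoning
    shuffle : ∀ x y c d → x + c + (y + c) + d ≡ x + y + (2 * c + d)
    shuffle = solve-∀

  -- After multiplication by 9t, the chain 9a ≤ 3n ≤ 8b + 7 replaces `a` by `b`. By `split` the
  -- multiples of `b` then cancel down to `y * b ≤ K`, against `large`.
  noGap : ∀ {n a b s} → 3 * a ≤ n → 3 * n ≤ 8 * b + 7 → s * s ≤ b → b₀ ≤ b →
    ¬ (expψ b ≤ expψ a * expψ s)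
  noGap {n} {a} {b} {s} 3a≤n 3n≤ s²≤b b₀≤b le = <⇒≱ large (≤-trans (*-monoʳ-≤ y b₀≤b)
    (+-cancelˡ-≤ (X * b) (y * b) K (begin
    X * b + y * b                                              ≡⟨ *-distribʳ-+ b X y ⟨
    (X + y) * b                                                ≡⟨ cong (_* b) split ⟩
    9 * t * l * b                                              ≡⟨ *-assoc (9 * t) l b ⟩
    9 * t * (l * b)                                            ≤⟨ *-monoʳ-≤ (9 * t) (exponents {a} {b} {s} le) ⟩
    9 * t * (u * a + u * s + c)                                ≡⟨ shuffle₁ t u a s c ⟩
    3 * t * u * (3 * a) + 9 * u * (t * s) + 9 * t * c          ≤⟨ +-monoˡ-≤ (9 * t * c) (+-mono-≤ (*-monoʳ-≤ (3 * t * u) 3a≤n) (*-monoʳ-≤ (9 * u) (sqrt-linear t s²≤b))) ⟩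
    3 * t * u * n + 9 * u * (b + t * t) + 9 * t * c            ≡⟨ shuffle₂ t u n (9 * u * (b + t * t)) (9 * t * c) ⟩
    t * u * (3 * n) + 9 * u * (b + t * t) + 9 * t * c          ≤⟨ +-monoˡ-≤ (9 * t * c) (+-monoˡ-≤ (9 * u * (b + t * t)) (*-monoʳ-≤ (t * u) 3n≤)) ⟩
    t * u * (8 * b + 7) + 9 * u * (b + t * t) + 9 * t * c      ≡⟨ shuffle₃ t u b c ⟩
    X * b + K                                                  ∎)))
    where
    open ≤-Reasoning
    c = 2 * cᵤ + cₗ
    X = t * (8 * u) + 9 * u
    K = t * u * 7 + 9 * u * (t * t) + 9 * t * c
    shuffle₁ : ∀ t u a s c → 9 * t * (u * a + u * s + c) ≡ 3 * t * u * (3 * a) + 9 * u * (t * s) + 9 * t * c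
    shuffle₁ = solve-∀
    shuffle₂ : ∀ t u n x y → 3 * t * u * n + x + y ≡ t * u * (3 * n) + x + y
    shuffle₂ = solve-∀
    shuffle₃ : ∀ t u b c → t * u * (8 * b + 7) + 9 * u * (b + t * t) + 9 * t * c ≡
      (t * (8 * u) + 9 * u) * b + (t * u * 7 + 9 * u * (t * t) + 9 * t * c)
    shuffle₃ = solve-∀

  witnessPrime : ∀ n → 3 ≤ n → b₀ * 8 ≤ 3 * n → ∃ (WitnessPrime n)
  witnessPrime n 3≤n b₀≤ with anyUpTo? (λ p → n / 3 <? p ×-dec prime? p) (suc (3 * n / 8))
  ... | yes (p , s≤s p≤b , a<p , pp) = p , pp , n<3p , m≤n⇒m≤1+n 8p≤3n
    where
    n<3p : n < 3 * p
    n<3p = <-≤-trans (m<[1+m/n]*n n 3) (subst (suc (n / 3) * 3 ≤_) (*-comm p 3) (*-monoˡ-≤ 3 a<p))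
    8p≤3n : 8 * p ≤ 3 * n
    8p≤3n = subst (_≤ 3 * n) (*-comm p 8) (≤-trans (*-monoˡ-≤ 8 p≤b) (m/n*n≤m (3 * n) 8))
  ... | no none with sqrt (3 * n / 8)
  ...   | s , s²≤b , b<s′² = contradiction
    (∣⇒≤ {{m*n≢0 (expψ a) (expψ s) {{>-nonZero (expψ≥1 a)}} {{>-nonZero (expψ≥1 s)}}}}
      (expψ-primeFree {s = s} a≤b b≤2a b<s′² (λ p a<p p≤b pp → none (p , s≤s p≤b , a<p , pp))))
    (noGap {a = a} {s = s} (subst (_≤ n) (*-comm a 3) (m/n*n≤m n 3)) 3n≤ s²≤b b₀≤b)
    where
    open ≤-Reasoning
    a = n / 3
    b = 3 * n / 8
    b₀≤b : b₀ ≤ b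
    b₀≤b = *≤⇒≤/ 8 b₀≤
    3n≤ : 3 * n ≤ 8 * b + 7
    3n≤ = s≤s⁻¹ (subst (3 * n <_) (shuffle b) (m<[1+m/n]*n (3 * n) 8))
      where
      shuffle : ∀ b → suc b * 8 ≡ suc (8 * b + 7)
      shuffle = solve-∀
    a≤b : a ≤ b
    a≤b = *≤⇒≤/ 8 (≤-trans (subst (a * 8 ≤_) (shuffle a) (*-monoʳ-≤ a {8} {9} (n≤1+n 8))) (*-monoʳ-≤ 3 (m/n*n≤m n 3)))
      where
      shuffle : ∀ a → a * 9 ≡ 3 * (a * 3)
      shuffle = solve-∀
    b≤2a : b ≤ 2 * a
    b≤2a = *-cancelʳ-≤ b (2 * a) 8 (begin
      b * 8                 ≤⟨ m/n*n≤m (3 * n) 8 ⟩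
      3 * n                 ≤⟨ *-monoʳ-≤ 3 (s≤s⁻¹ (m<[1+m/n]*n n 3)) ⟩
      3 * (2 + a * 3)       ≡⟨ shuffle₁ a ⟩
      9 * a + 6 * 1         ≤⟨ +-monoʳ-≤ (9 * a) (*-monoʳ-≤ 6 (m≥n⇒m/n>0 3≤n)) ⟩
      9 * a + 6 * a         ≤⟨ m≤m+n _ a ⟩
      9 * a + 6 * a + a     ≡⟨ shuffle₂ a ⟩
      2 * a * 8             ∎)
      where
      shuffle₁ : ∀ a → 3 * (2 + a * 3) ≡ 9 * a + 6 * 1
      shuffle₁ = solve-∀
      shuffle₂ : ∀ a → 9 * a + 6 * a + a ≡ 2 * a * 8
      shuffle₂ = solve-∀

-- Each prime is at most about 9/8 of the preceding one. The chain cannot start before 99: for n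
-- from 93 to 98 no prime satisfies n/3 < p ≤ (3n + 1)/8.
smallWitnessPrimes : List ℕ
smallWitnessPrimes =
  37 ∷ 41 ∷ 43 ∷ 47 ∷ 53 ∷ 59 ∷ 61 ∷ 67 ∷ 73 ∷ 79 ∷ 89 ∷ 97 ∷ 109 ∷ 113 ∷ 127 ∷ 139 ∷ 151 ∷
  167 ∷ 181 ∷ 199 ∷ 223 ∷ 251 ∷ 281 ∷ 313 ∷ 349 ∷ 389 ∷ 433 ∷ 487 ∷ 547 ∷ 613 ∷ 683 ∷ 761 ∷
  853 ∷ 953 ∷ 1069 ∷ 1201 ∷ 1327 ∷ 1493 ∷ 1669 ∷ 1877 ∷ 2111 ∷ 2371 ∷ 2663 ∷ 2971 ∷ 3331 ∷
  3739 ∷ 4201 ∷ 4723 ∷ 5309 ∷ 5953 ∷ 6691 ∷ 7523 ∷ 8461 ∷ 9511 ∷ 10691 ∷ 12011 ∷ 13499 ∷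
  15173 ∷ 17053 ∷ 19183 ∷ 21577 ∷ 24251 ∷ 27281 ∷ 30689 ∷ 34519 ∷ 38833 ∷ 43669 ∷ 49123 ∷
  55259 ∷ 62143 ∷ 69911 ∷ 78649 ∷ 88471 ∷ 99529 ∷ 111959 ∷ 125941 ∷ 141679 ∷ 159389 ∷ 179287 ∷
  201683 ∷ 226871 ∷ 255217 ∷ 287117 ∷ 323003 ∷ 363373 ∷ 408787 ∷ 459883 ∷ 517367 ∷ 582037 ∷
  654781 ∷ 736607 ∷ 828677 ∷ 932257 ∷ 1048783 ∷ 1179869 ∷ 1327351 ∷ 1493257 ∷ 1679903 ∷
  1889831 ∷ 2126041 ∷ 2391769 ∷ 2690719 ∷ 3027047 ∷ 3405397 ∷ 3831067 ∷ 4309939 ∷ 4848673 ∷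
  5454751 ∷ 6136577 ∷ 6903647 ∷ 7766599 ∷ 8737423 ∷ 9829591 ∷ 11058287 ∷ 12440567 ∷ 13995629 ∷
  15745069 ∷ 17713193 ∷ 19927337 ∷ 22418237 ∷ 25220491 ∷ 28373047 ∷ 31919647 ∷ 35909597 ∷
  40398289 ∷ 45448063 ∷ 51129007 ∷ 57520093 ∷ 64710103 ∷ 72798863 ∷ 81898693 ∷ 92136029 ∷
  103653031 ∷ 116609659 ∷ 131185853 ∷ 147584057 ∷ 166032037 ∷ 186786031 ∷ 210134273 ∷
  236401043 ∷ 265951163 ∷ 299195011 ∷ 336594383 ∷ []

∃-witnessPrime : ∀ n → 99 ≤ n → ∃ (WitnessPrime n)
∃-witnessPrime n 99≤n with n <? 10 ^ 9
... | yes n< = chain-sound 99 (10 ^ 9) smallWitnessPrimes _ n 99≤n n<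
... | no n≮ = witnessPrime n (≤-trans (≤ᵇ⇒≤ 3 99 _) 99≤n) (*-monoʳ-≤ 3 (≮⇒≥ n≮))
  -- Here `t` is 10000, `y` the resulting surplus and `b₀` = 3 · 10⁹ / 8. In `large` the term with
  -- the additive constants `cᵤ` and `cₗ` dominates and dictates a threshold of this order.
  where open LargeRange upper₆ lower₃ 10000 46909768 375000000 refl (≤ᵇ⇒≤ _ _ _)

-- Farey products

numerator denominator : ℕ × ℕ → ℕ
numerator = suc ∘ proj₁
denominator = suc ∘ proj₂

numerators denominators : List (ℕ × ℕ) → ℕ
numerators = product ∘ map numerator
denominators = product ∘ map denominator

-- Unnormalised rationals multiply without reduction, so both products stay visible. `mkℚᵘ` stores
-- the denominator minus one, hence `d`.
toℚᵘ-productℚ : ∀ ps → ∃ λ d → suc d ≡ denominators ps ×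
  toℚᵘ (productℚ (map toFraction ps)) ≃ mkℚᵘ (+ numerators ps) d
toℚᵘ-productℚ []             = 0 , refl , ℚᵘ.≃-refl
toℚᵘ-productℚ ((i , j) ∷ ps) with toℚᵘ-productℚ ps
... | d , eq , ih = d + j * suc d , cong (suc j *_) eq , (begin-equality
  toℚᵘ (toFraction (i , j) ℚ.* productℚ (map toFraction ps))
    ≃⟨ ℚ.toℚᵘ-homo-* (toFraction (i , j)) (productℚ (map toFraction ps)) ⟩
  toℚᵘ (toFraction (i , j)) ℚᵘ.* toℚᵘ (productℚ (map toFraction ps))
    ≃⟨ ℚᵘ.*-cong (ℚ.toℚᵘ-fromℚᵘ (mkℚᵘ (+ suc i) j)) ih ⟩
  mkℚᵘ (+ suc i) j ℚᵘ.* mkℚᵘ (+ numerators ps) d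
    ≃⟨ *≡* (cong (ℤ._* (+ (suc j * suc d))) (sym (ℤ.pos-* (suc i) (numerators ps)))) ⟩
  mkℚᵘ (+ (suc i * numerators ps)) (d + j * suc d) ∎)
  where open ℚᵘ.≤-Reasoning

fareyNumerators : ℕ → ℕ
fareyNumerators n = numerators (fareyIndices n)

fareyDenominators : ℕ → ℕ
fareyDenominators n = denominators (fareyIndices n)

fareyProduct*≃ : ∀ n z → ∃ λ d → suc d ≡ fareyDenominators n ×
  toℚᵘ (fareyProduct n ℚ.* (z ℚ./ 1)) ≃ mkℚᵘ (+ fareyNumerators n) d ℚᵘ.* mkℚᵘ z 0
fareyProduct*≃ n z with toℚᵘ-productℚ (fareyIndices n)
... | d , eq , P≃ = d , eq ,
  ℚᵘ.≃-trans (ℚ.toℚᵘ-homo-* (fareyProduct n) (z ℚ./ 1)) (ℚᵘ.*-cong P≃ (ℚ.toℚᵘ-fromℚᵘ (mkℚᵘ z 0)))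

-- If the reciprocal is `z`, the Farey product times `z` is 1; over the unreduced fraction N/D this
-- reads N z = D.
isInteger⇒∣ : ∀ n → IsInteger (F̄ n) → fareyNumerators n ∣ fareyDenominators n
isInteger⇒∣ n (z , F̄≡z) with fareyProduct*≃ n z
... | d , eq , P≃ = divides ℤ.∣ z ∣ (begin
  fareyDenominators n                       ≡⟨ eq ⟨
  suc d                                     ≡⟨ cong ℤ.∣_∣ integral ⟨
  ℤ.∣ + fareyNumerators n ℤ.* z ∣                     ≡⟨ ℤ.abs-* (+ fareyNumerators n) z ⟩
  fareyNumerators n * ℤ.∣ z ∣                         ≡⟨ *-comm (fareyNumerators n) _ ⟩
  ℤ.∣ z ∣ * fareyNumerators n                         ∎)
  where
  open ≡-Reasoning
  P*z≡1 : fareyProduct n ℚ.* (z ℚ./ 1) ≡ 1ℚ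
  P*z≡1 = trans (cong (fareyProduct n ℚ.*_) (sym F̄≡z)) (ℚ.*-inverseʳ (fareyProduct n) {{fareyProduct-nonZero n}})
  P*z≃1 : mkℚᵘ (+ fareyNumerators n) d ℚᵘ.* mkℚᵘ z 0 ≃ 1ℚᵘ
  P*z≃1 = ℚᵘ.≃-trans (ℚᵘ.≃-sym P≃) (ℚ.toℚᵘ-cong P*z≡1)
  integral : + fareyNumerators n ℤ.* z ≡ + suc d
  integral with *≡* e ← P*z≃1 = begin
    + fareyNumerators n ℤ.* z                ≡⟨ ℤ.*-identityʳ _ ⟨
    + fareyNumerators n ℤ.* z ℤ.* + 1        ≡⟨ e ⟩
    + 1 ℤ.* + (suc d * 1)          ≡⟨ ℤ.*-identityˡ _ ⟩
    + (suc d * 1)                  ≡⟨ cong +_ (*-identityʳ (suc d)) ⟩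
    + suc d                        ∎

∣⇒isInteger : ∀ n → fareyNumerators n ∣ fareyDenominators n → IsInteger (F̄ n)
∣⇒isInteger n (divides q eq′) with fareyProduct*≃ n (+ q)
... | d , eq , P≃ = + q , (begin
  F̄ n                                               ≡⟨ ℚ.*-identityʳ (F̄ n) ⟨
  F̄ n ℚ.* 1ℚ                                        ≡⟨ cong (F̄ n ℚ.*_) P*q≡1 ⟨
  F̄ n ℚ.* (fareyProduct n ℚ.* (+ q ℚ./ 1))          ≡⟨ ℚ.*-assoc (F̄ n) (fareyProduct n) (+ q ℚ./ 1) ⟨
  F̄ n ℚ.* fareyProduct n ℚ.* (+ q ℚ./ 1)            ≡⟨ cong (ℚ._* (+ q ℚ./ 1)) (ℚ.*-inverseˡ (fareyProduct n) {{fareyProduct-nonZero n}}) ⟩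
  1ℚ ℚ.* (+ q ℚ./ 1)                                ≡⟨ ℚ.*-identityˡ (+ q ℚ./ 1) ⟩
  + q ℚ./ 1                                         ∎)
  where
  open ≡-Reasoning
  one : mkℚᵘ (+ fareyNumerators n) d ℚᵘ.* mkℚᵘ (+ q) 0 ≃ 1ℚᵘ
  one = *≡* (begin
    + fareyNumerators n ℤ.* + q ℤ.* + 1      ≡⟨ ℤ.*-identityʳ _ ⟩
    + fareyNumerators n ℤ.* + q              ≡⟨ ℤ.pos-* (fareyNumerators n) q ⟨
    + (fareyNumerators n * q)                ≡⟨ cong +_ (trans (*-comm (fareyNumerators n) q) (trans (sym eq′) (sym eq))) ⟩
    + suc d                        ≡⟨ cong +_ (*-identityʳ (suc d)) ⟨
    + (suc d * 1)                  ≡⟨ ℤ.*-identityˡ _ ⟨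
    + 1 ℤ.* + (suc d * 1)          ∎)
  P*q≡1 : fareyProduct n ℚ.* (+ q ℚ./ 1) ≡ 1ℚ
  P*q≡1 = ℚ.toℚᵘ-injective (ℚᵘ.≃-trans P≃ one)

-- Multiplicity of a prime in a product

length-⊆ : ∀ {A : Set} {xs ys : List A} → Unique xs → (∀ {x} → x ∈ xs → x ∈ ys) → length xs ≤ length ys
length-⊆ [] sub = z≤n
length-⊆ {xs = x ∷ xs} (x∉xs ∷ xs!) sub with as , bs , refl ← ∈-∃++ (sub (here refl)) =
  subst (suc (length xs) ≤_) (sym len) (s≤s (length-⊆ xs! sub′))
  where
  len : length (as ++ x ∷ bs) ≡ suc (length (as ++ bs))
  len = trans (length-++ as) (trans (+-suc (length as) (length bs)) (cong suc (sym (length-++ as))))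
  sub′ : ∀ {y} → y ∈ xs → y ∈ as ++ bs
  sub′ y∈xs with ∈-++⁻ as (sub (there y∈xs))
  ... | inj₁ y∈as = ∈-++⁺ˡ y∈as
  ... | inj₂ (here refl) = contradiction refl (All.lookup x∉xs y∈xs)
  ... | inj₂ (there y∈bs) = ∈-++⁺ʳ as y∈bs

-- A positive multiple of `p` below `p * p` contains `p` exactly once, so the multiplicity in the
-- product is the number of multiples.
product-primePart : ∀ {A : Set} {p} (f : A → ℕ) → Prime p → ∀ xs →
  All (λ x → 0 < f x × f x < p * p) xs →
  ∃ λ u → product (map f xs) ≡ p ^ length (filter (λ x → p ∣? f x) xs) * u × ¬ (p ∣ u)
product-primePart f pp [] [] = 1 , refl , λ p∣1 → ¬prime[1] (subst Prime (∣1⇒≡1 p∣1) pp)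
product-primePart {p = p} f pp (x ∷ xs) ((0<fx , fx<p²) ∷ bounds) with product-primePart f pp xs bounds | p ∣? f x
... | u , eq , p∤u | no p∤fx = f x * u , trans (cong (f x *_) eq) (shuffle (f x) (p ^ length (filter (λ x → p ∣? f x) xs)) u) , p∤fxu
  where
  shuffle : ∀ a b c → a * (b * c) ≡ b * (a * c)
  shuffle = solve-∀
  p∤fxu : ¬ (p ∣ f x * u)
  p∤fxu d with euclidsLemma (f x) u pp d
  ... | inj₁ p∣fx = p∤fx p∣fx
  ... | inj₂ p∣u  = p∤u p∣u
... | u , eq , p∤u | yes (divides q fx≡qp) = q * u , trans (cong₂ _*_ fx≡qp eq) (shuffle q p (p ^ length (filter (λ x → p ∣? f x) xs)) u) , p∤qu
  where
  shuffle : ∀ q p b u → q * p * (b * u) ≡ p * b * (q * u)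
  shuffle = solve-∀
  q≢0 : NonZero q
  q≢0 = ≢-nonZero λ { refl → <⇒≢ 0<fx (sym fx≡qp) }
  q<p : q < p
  q<p = *-cancelʳ-< p q p (subst (_< p * p) fx≡qp fx<p²)
  p∤qu : ¬ (p ∣ q * u)
  p∤qu d with euclidsLemma q u pp d
  ... | inj₁ p∣q = <⇒≱ q<p (∣⇒≤ {{q≢0}} p∣q)
  ... | inj₂ p∣u = p∤u p∣u

product-∣⇒count-≤ : ∀ {A : Set} {p} (f g : A → ℕ) → Prime p → ∀ xs →
  All (λ x → 0 < f x × f x < p * p) xs → All (λ x → 0 < g x × g x < p * p) xs →
  product (map f xs) ∣ product (map g xs) →
  length (filter (λ x → p ∣? f x) xs) ≤ length (filter (λ x → p ∣? g x) xs)
product-∣⇒count-≤ {p = p} f g pp xs fs gs f∣g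
  with u , f≡ , _ ← product-primePart f pp xs fs
  with w , g≡ , p∤w ← product-primePart g pp xs gs
  with cf ← length (filter (λ x → p ∣? f x) xs)
  with cg ← length (filter (λ x → p ∣? g x) xs)
  with cf ≤? cg
... | yes le = le
... | no ¬le = contradiction (*-cancelˡ-∣ (p ^ cg) {{m^n≢0 p cg {{prime⇒nonZero pp}}}}
    (subst₂ _∣_ (*-comm p (p ^ cg)) g≡ (∣-trans (^-monoʳ-∣ p (≰⇒> ¬le)) (∣-trans (subst (p ^ cf ∣_) (sym f≡) (m∣m*n u)) f∣g)))) p∤w

noCommonPrime⇒gcd≡1 : ∀ a b .{{_ : NonZero a}} → (∀ q → Prime q → q ∣ a → ¬ (q ∣ b)) → gcd a b ≡ 1
noCommonPrime⇒gcd≡1 a b none with factorise (gcd a b) {{≢-nonZero gcd≢0}}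
  where
  gcd≢0 : gcd a b ≢ 0
  gcd≢0 eq = ≢-nonZero⁻¹ a (0∣⇒≡0 (subst (_∣ a) eq (gcd[m,n]∣m a b)))
... | record { factors = [] ; isFactorisation = eq } = eq
... | record { factors = q ∷ qs ; isFactorisation = eq ; factorsPrime = pq ∷ _ } =
  contradiction (∣-trans q∣gcd (gcd[m,n]∣n a b)) (none q pq (∣-trans q∣gcd (gcd[m,n]∣m a b)))
  where
  q∣gcd : q ∣ gcd a b
  q∣gcd = subst (q ∣_) (sym eq) (m∣m*n (product qs))

inFarey? : (ij : ℕ × ℕ) → Dec (suc (proj₁ ij) ≤ suc (proj₂ ij) × gcd (suc (proj₁ ij)) (suc (proj₂ ij)) ≡ 1)
inFarey? (i , j) = (suc i ≤? suc j) ×-dec (gcd (suc i) (suc j) ≟ 1)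

∈-fareyIndices⁺ : ∀ {n i j} → i ≤ j → j < n → gcd (suc i) (suc j) ≡ 1 → (i , j) ∈ fareyIndices n
∈-fareyIndices⁺ i≤j j<n coprime = ∈-filter⁺ inFarey?
  (∈-cartesianProduct⁺ (∈-upTo⁺ (≤-<-trans i≤j j<n)) (∈-upTo⁺ j<n)) (s≤s i≤j , coprime)

∈-fareyIndices⁻ : ∀ {n i j} → (i , j) ∈ fareyIndices n → i ≤ j × j < n × gcd (suc i) (suc j) ≡ 1
∈-fareyIndices⁻ {n} ij∈ with ∈-filter⁻ inFarey? {xs = cartesianProduct (upTo n) (upTo n)} ij∈
... | ij∈× , s≤s i≤j , coprime = i≤j , ∈-upTo⁻ (proj₂ (∈-cartesianProduct⁻ (upTo n) (upTo n) ij∈×)) , coprime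

fareyIndices! : ∀ n → Unique (fareyIndices n)
fareyIndices! n = Unique.filter⁺ inFarey? (Unique.cartesianProduct⁺ (Unique.upTo⁺ n) (Unique.upTo⁺ n))

even⊎odd : ∀ n → ∃ λ k → n ≡ 2 * k ⊎ n ≡ suc (2 * k)
even⊎odd zero = 0 , inj₁ refl
even⊎odd (suc n) with even⊎odd n
... | k , inj₁ refl = k , inj₂ refl
... | k , inj₂ refl = suc k , inj₁ (sym (*-suc 2 k))

-- For n = 2p + r with r < p, the prime p divides k only for k = p, 2p and h only
-- for h = p, 2p, always exactly once.
module Valuation (m r : ℕ) (pp : Prime (suc (2 * m))) (r<p : r < suc (2 * m)) where

  p n c : ℕ
  p = suc (2 * m)
  n = 2 * p + r
  -- ⌈r/2⌉, the number of odd k with 2p < k ≤ 2p + r.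
  c = suc r / 2

  p∤suc[ap+k] : ∀ {k} a → suc k < p → ¬ (p ∣ suc (a * p + k))
  p∤suc[ap+k] {k} a k<p p∣ = <⇒≱ k<p (∣⇒≤ (∣m+n∣m⇒∣n (subst (p ∣_) (sym (+-suc (a * p) k)) p∣) (n∣m*n a)))

  p+p : suc (p + 2 * m) ≡ 2 * p
  p+p = double m
    where
    double : ∀ m → suc (suc (2 * m) + 2 * m) ≡ 2 * suc (2 * m)
    double = solve-∀

  coprime-p : ∀ {k} a → suc k < p → gcd (suc (2 * m)) (suc (a * p + k)) ≡ 1
  coprime-p a k<p = noCommonPrime⇒gcd≡1 p _ λ q pq q∣p q∣k →
    p∤suc[ap+k] a k<p (subst (_∣ suc (a * p + _)) (prime∣prime⇒≡ pq pp q∣p) q∣k)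

  coprime-2p : ∀ {k} → suc (2 * k) < p → gcd (suc (p + 2 * m)) (suc (2 * p + 2 * k)) ≡ 1
  coprime-2p {k} k<p = noCommonPrime⇒gcd≡1 (suc (p + 2 * m)) _ λ q pq q∣2p q∣k →
    case q pq (euclidsLemma 2 p pq (subst (q ∣_) p+p q∣2p)) q∣k
    where
    case : ∀ q → Prime q → q ∣ 2 ⊎ q ∣ p → ¬ (q ∣ suc (2 * p + 2 * k))
    case q pq (inj₂ q∣p) q∣k = p∤suc[ap+k] 2 k<p (subst (_∣ suc (2 * p + 2 * k)) (prime∣prime⇒≡ pq pp q∣p) q∣k)
    case q pq (inj₁ q∣2) q∣k with refl ← prime∣prime⇒≡ pq prime[2] q∣2 =
      contradiction (∣1⇒≡1 (∣m+n∣m⇒∣n (subst (2 ∣_) (shuffle p k) q∣k) (m∣m*n (p + k)))) λ ()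
      where
      shuffle : ∀ p k → suc (2 * p + 2 * k) ≡ 2 * (p + k) + 1
      shuffle = solve-∀

  -- Indices are one less than h and k. The pieces are h = p with p < k < 2p, h = p with 2p < k ≤ 2p
  -- + r, and h = 2p with odd k in the latter range. It suffices that they occur among the Farey
  -- fractions, as only a lower bound is wanted here.
  withNumerator₁ withNumerator₂ withNumerator₃ withNumerator : List (ℕ × ℕ)
  withNumerator₁ = map (λ k → 2 * m , 1 * p + k) (upTo (2 * m))
  withNumerator₂ = map (λ k → 2 * m , 2 * p + k) (upTo r)
  withNumerator₃ = map (λ k → p + 2 * m , 2 * p + 2 * k) (upTo c)
  withNumerator = withNumerator₁ ++ withNumerator₂ ++ withNumerator₃

  withNumerator! : Unique withNumerator
  withNumerator! =
    Unique.++⁺ (Unique.map⁺ (+-cancelˡ-≡ (1 * p) _ _ ∘ cong proj₂) (Unique.upTo⁺ _))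
    (Unique.++⁺ (Unique.map⁺ (+-cancelˡ-≡ (2 * p) _ _ ∘ cong proj₂) (Unique.upTo⁺ _))
      (Unique.map⁺ (*-cancelˡ-≡ _ _ 2 ∘ +-cancelˡ-≡ (2 * p) _ _ ∘ cong proj₂) (Unique.upTo⁺ _))
      disjoint₂₃)
    disjoint₁
    where
    below : ∀ {v} → v ∈ withNumerator₁ → proj₂ v < 2 * p
    below v∈ with k , k∈ , refl ← ∈-map⁻ _ v∈ = subst (suc (p + 0 + k) ≤_) p+p
      (s≤s (+-mono-≤ (≤-reflexive (+-identityʳ p)) (<⇒≤ (∈-upTo⁻ k∈))))
    above : ∀ {v} → v ∈ withNumerator₂ ++ withNumerator₃ → 2 * p ≤ proj₂ v
    above v∈ with ∈-++⁻ withNumerator₂ v∈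
    ... | inj₁ v∈₂ with k , _ , refl ← ∈-map⁻ _ v∈₂ = m≤m+n (2 * p) k
    ... | inj₂ v∈₃ with k , _ , refl ← ∈-map⁻ _ v∈₃ = m≤m+n (2 * p) (2 * k)
    disjoint₁ : ∀ {v} → ¬ (v ∈ withNumerator₁ × v ∈ withNumerator₂ ++ withNumerator₃)
    disjoint₁ (v∈₁ , v∈) = <⇒≱ (below v∈₁) (above v∈)
    disjoint₂₃ : ∀ {v} → ¬ (v ∈ withNumerator₂ × v ∈ withNumerator₃)
    disjoint₂₃ (v∈₂ , v∈₃) with k , _ , refl ← ∈-map⁻ _ v∈₂ | l , _ , eq ← ∈-map⁻ _ v∈₃ =
      m≢1+n+m (2 * m) {2 * m} (cong proj₁ eq)

  p∣numerator? : (ij : ℕ × ℕ) → Dec (p ∣ numerator ij)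
  p∣numerator? ij = p ∣? numerator ij

  p∣denominator? : (ij : ℕ × ℕ) → Dec (p ∣ denominator ij)
  p∣denominator? ij = p ∣? denominator ij

  withNumerator⊆ : ∀ {v} → v ∈ withNumerator → v ∈ filter p∣numerator? (fareyIndices n)
  withNumerator⊆ v∈ with ∈-++⁻ withNumerator₁ v∈
  ... | inj₁ v∈₁ with k , k∈ , refl ← ∈-map⁻ _ v∈₁ = ∈-filter⁺ p∣numerator?
        (∈-fareyIndices⁺ (≤-trans (n≤1+n (2 * m)) (≤-trans (m≤m+n p 0) (m≤m+n (1 * p) k)))
          (≤-trans (subst (suc (p + 0 + k) ≤_) p+p (s≤s (+-mono-≤ (≤-reflexive (+-identityʳ p)) (<⇒≤ (∈-upTo⁻ k∈))))) (m≤m+n (2 * p) r))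
          (coprime-p 1 (s≤s (∈-upTo⁻ k∈)))) ∣-refl
  ... | inj₂ v∈′ with ∈-++⁻ withNumerator₂ v∈′
  ...   | inj₁ v∈₂ with k , k∈ , refl ← ∈-map⁻ _ v∈₂ = ∈-filter⁺ p∣numerator?
        (∈-fareyIndices⁺ (≤-trans (n≤1+n (2 * m)) (≤-trans (m≤m+n p (1 * p)) (m≤m+n (2 * p) k)))
          (+-monoʳ-< (2 * p) (∈-upTo⁻ k∈))
          (coprime-p 2 (≤-<-trans (∈-upTo⁻ k∈) r<p))) ∣-refl
  ...   | inj₂ v∈₃ with k , k∈ , refl ← ∈-map⁻ _ v∈₃ = ∈-filter⁺ p∣numerator?
        (∈-fareyIndices⁺ (≤-trans (n≤1+n _) (≤-trans (≤-reflexive p+p) (m≤m+n (2 * p) (2 * k))))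
          (+-monoʳ-< (2 * p) 1+2k≤r)
          (coprime-2p {k} (≤-<-trans 1+2k≤r r<p))) (subst (p ∣_) (sym p+p) (n∣m*n 2))
    where
    1+2k≤r : suc (2 * k) ≤ r
    1+2k≤r = s≤s⁻¹ (≤-trans (≤-reflexive (shuffle k)) (≤-trans (*-monoˡ-≤ 2 (∈-upTo⁻ k∈)) (m/n*n≤m (suc r) 2)))
      where
      shuffle : ∀ k → suc (suc (2 * k)) ≡ suc k * 2
      shuffle = solve-∀

  -- The pieces are k = p with h < p, and k = 2p with h odd, below p and above p. Here the opposite
  -- inclusion is needed, since it bounds the count from above.
  withDenominator₁ withDenominator₂ withDenominator₃ withDenominator : List (ℕ × ℕ)
  withDenominator₁ = map (λ k → k , 2 * m) (upTo (2 * m))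
  withDenominator₂ = map (λ k → 2 * k , p + 2 * m) (upTo m)
  withDenominator₃ = map (λ k → 2 * (suc m + k) , p + 2 * m) (upTo m)
  withDenominator = withDenominator₁ ++ withDenominator₂ ++ withDenominator₃

  notCoprime : ∀ {q a b} → Prime q → q ∣ a → q ∣ b → gcd a b ≢ 1
  notCoprime pq q∣a q∣b eq = ¬prime[1] (subst Prime (∣1⇒≡1 (subst (_ ∣_) eq (gcd-greatest q∣a q∣b))) pq)

  ⊆withDenominator : ∀ {v} → v ∈ filter p∣denominator? (fareyIndices n) → v ∈ withDenominator
  ⊆withDenominator {i , j} v∈ with ∈-filter⁻ p∣denominator? {xs = fareyIndices n} v∈
  ... | ij∈ , divides t j≡ with ∈-fareyIndices⁻ {n} ij∈
  ...   | i≤j , j<n , coprime with t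
  -- In `suc j = t * p` only `t = 1` and `t = 2` survive, because n < 3p.
  ...     | 1 with refl ← suc-injective (trans j≡ (+-identityʳ p)) = ∈-++⁺ˡ (∈-map⁺ _ (∈-upTo⁺
              (≤∧≢⇒< i≤j λ { refl → notCoprime {b = p} pp ∣-refl ∣-refl coprime })))
  ...     | 0 with () ← j≡
  ...     | suc (suc (suc t)) = contradiction (<-≤-trans (≤-<-trans j<n n<3p) 3p≤j) (<-irrefl refl)
    where
    n<3p : n < 3 * p
    n<3p = subst (n <_) (shuffle p) (+-monoʳ-< (2 * p) r<p)
      where
      shuffle : ∀ p → 2 * p + p ≡ 3 * p
      shuffle = solve-∀
    3p≤j : 3 * p ≤ suc j
    3p≤j = subst (3 * p ≤_) (sym j≡) (*-monoˡ-≤ p (m≤m+n 3 t))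
  -- An odd index `i` means an even h, which shares the factor 2 with k = 2p. Even indices are
  -- compared with `2 * m`, that is h with p.
  ...     | 2 with refl ← suc-injective (trans j≡ (sym p+p)) with even⊎odd i
  ...       | k , inj₂ refl = contradiction coprime (notCoprime prime[2]
                (subst (2 ∣_) (shuffle k) (m∣m*n (suc k))) (subst (2 ∣_) (sym p+p) (m∣m*n p)))
    where
    shuffle : ∀ k → 2 * suc k ≡ suc (suc (2 * k))
    shuffle = solve-∀
  ...       | k , inj₁ refl with <-cmp k m
  ...         | tri< k<m _ _ = ∈-++⁺ʳ withDenominator₁ (∈-++⁺ˡ (∈-map⁺ _ (∈-upTo⁺ k<m)))
  ...         | tri≈ _ refl _ = contradiction coprime (notCoprime pp ∣-refl (subst (p ∣_) (sym p+p) (n∣m*n 2)))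
  ...         | tri> _ _ m<k with l , refl ← m≤n⇒∃[o]m+o≡n m<k = ∈-++⁺ʳ withDenominator₁ (∈-++⁺ʳ withDenominator₂
                (∈-map⁺ _ (∈-upTo⁺ (*-cancelˡ-< 2 l m (+-cancelˡ-< (2 * suc m) _ _ l<)))))
    where
    l< : 2 * suc m + 2 * l < 2 * suc m + 2 * m
    l< = subst₂ _<_ (*-distribˡ-+ 2 (suc m) l) (shuffle m) (s≤s i≤j)
      where
      shuffle : ∀ m → suc (suc (2 * m) + 2 * m) ≡ 2 * suc m + 2 * m
      shuffle = solve-∀

  -- Provides the bounds for `product-primePart`: h, k ≤ n < 3p ≤ p².
  bounded : (f : ℕ × ℕ → ℕ) → (∀ {i j} → i ≤ j → f (i , j) ≤ suc j) → (∀ ij → 0 < f ij) → 3 ≤ p →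
    All (λ ij → 0 < f ij × f ij < p * p) (fareyIndices n)
  bounded f f≤ 0<f 3≤p = All.tabulate λ {ij} ij∈ →
    let i≤j , j<n , _ = ∈-fareyIndices⁻ {n} ij∈ in
    0<f ij , ≤-<-trans (f≤ i≤j) (≤-<-trans j<n (<-≤-trans (+-monoʳ-< (2 * p) r<p) (≤-trans (≤-reflexive (shuffle p)) (*-monoˡ-≤ p 3≤p))))
    where
    shuffle : ∀ p → 2 * p + p ≡ 3 * p
    shuffle = solve-∀

  farey∤ : 3 ≤ p → 8 * p ≤ suc (3 * n) → ¬ (fareyNumerators n ∣ fareyDenominators n)
  farey∤ 3≤p 8p≤ N∣D = <⇒≱ key (begin
    2 * (2 * m + (r + c))               ≡⟨ cong (2 *_) numeratorCount ⟨
    2 * length withNumerator            ≤⟨ *-monoʳ-≤ 2 (length-⊆ withNumerator! withNumerator⊆) ⟩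
    2 * length (filter p∣numerator? (fareyIndices n))
      ≤⟨ *-monoʳ-≤ 2 (product-∣⇒count-≤ numerator denominator pp (fareyIndices n)
           (bounded numerator s≤s (λ _ → z<s) 3≤p) (bounded denominator (λ _ → ≤-refl) (λ _ → z<s) 3≤p) N∣D) ⟩
    2 * length (filter p∣denominator? (fareyIndices n))
      ≤⟨ *-monoʳ-≤ 2 (length-⊆ (Unique.filter⁺ p∣denominator? (fareyIndices! n)) ⊆withDenominator) ⟩
    2 * length withDenominator          ≡⟨ cong (2 *_) denominatorCount ⟩
    2 * (2 * m + (m + m))               ∎)
    where
    open ≤-Reasoning
    length-map-upTo : ∀ (f : ℕ → ℕ × ℕ) k → length (map f (upTo k)) ≡ k
    length-map-upTo f k = trans (length-map f (upTo k)) (length-upTo k)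
    numeratorCount : length withNumerator ≡ 2 * m + (r + c)
    numeratorCount = trans (length-++ withNumerator₁) (cong₂ _+_ (length-map-upTo _ (2 * m))
      (trans (length-++ withNumerator₂) (cong₂ _+_ (length-map-upTo _ r) (length-map-upTo _ c))))
    denominatorCount : length withDenominator ≡ 2 * m + (m + m)
    denominatorCount = trans (length-++ withDenominator₁) (cong₂ _+_ (length-map-upTo _ (2 * m))
      (trans (length-++ withDenominator₂) (cong₂ _+_ (length-map-upTo _ m) (length-map-upTo _ m))))
    r≤2c : r ≤ c * 2
    r≤2c = s≤s⁻¹ (s≤s⁻¹ (m<[1+m/n]*n (suc r) 2))
    -- The hypothesis amounts to 4m + 1 ≤ 3r, and 3r ≤ 2r + 2c; the counts are doubled to avoid
    -- halves.
    key : 2 * (2 * m + (m + m)) < 2 * (2 * m + (r + c))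
    key = +-cancelˡ-≤ (8 * m + 7) _ _ (begin
      8 * m + 7 + suc (2 * (2 * m + (m + m)))   ≡⟨ shuffle₁ m ⟩
      8 * p                                     ≤⟨ 8p≤ ⟩
      suc (3 * n)                               ≡⟨ shuffle₂ m r ⟩
      8 * m + 7 + (4 * m + 2 * r + r)           ≤⟨ +-monoʳ-≤ (8 * m + 7) (+-monoʳ-≤ (4 * m + 2 * r) r≤2c) ⟩
      8 * m + 7 + (4 * m + 2 * r + c * 2)       ≡⟨ cong (λ z → 8 * m + 7 + z) (shuffle₃ m r c) ⟩
      8 * m + 7 + 2 * (2 * m + (r + c))         ∎)
      where
      shuffle₁ : ∀ m → 8 * m + 7 + suc (2 * (2 * m + (m + m))) ≡ 8 * suc (2 * m)
      shuffle₁ = solve-∀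
      shuffle₂ : ∀ m r → suc (3 * (2 * suc (2 * m) + r)) ≡ 8 * m + 7 + (4 * m + 2 * r + r)
      shuffle₂ = solve-∀
      shuffle₃ : ∀ m r c → 4 * m + 2 * r + c * 2 ≡ 2 * (2 * m + (r + c))
      shuffle₃ = solve-∀

-- An even `p` would be 2 and force n < 6. From 8p ≤ 3n + 1 follows 2p ≤ n, and n < 3p gives r < p,
-- so `Valuation` applies.
witnessPrime⇒farey∤ : ∀ {n p} → 6 ≤ n → WitnessPrime n p → ¬ (fareyNumerators n ∣ fareyDenominators n)
witnessPrime⇒farey∤ {n} {p} 6≤n (pp , n<3p , 8p≤) with even⊎odd p
... | m , inj₁ refl = contradiction (subst (λ q → n < 3 * q) (sym (prime∣prime⇒≡ prime[2] pp (m∣m*n m))) n<3p) (≤⇒≯ 6≤n)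
... | m , inj₂ refl = subst (λ n → ¬ (fareyNumerators n ∣ fareyDenominators n)) n≡
    (Valuation.farey∤ m r pp r<p 3≤p (subst (λ n → 8 * p ≤ suc (3 * n)) (sym n≡) 8p≤))
  where
  r = n ∸ 2 * p
  6p≤3n : 3 * (2 * p) ≤ 3 * n
  6p≤3n = s≤s⁻¹ (begin
    suc (3 * (2 * p))       ≡⟨ +-comm 1 (3 * (2 * p)) ⟩
    3 * (2 * p) + 1         ≤⟨ +-monoʳ-≤ (3 * (2 * p)) (s≤s z≤n) ⟩
    3 * (2 * p) + 2 * p     ≡⟨ shuffle p ⟩
    8 * p                   ≤⟨ 8p≤ ⟩
    suc (3 * n)             ∎)
    where
    open ≤-Reasoning
    shuffle : ∀ p → 3 * (2 * p) + 2 * p ≡ 8 * p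
    shuffle = solve-∀
  n≡ : 2 * p + r ≡ n
  n≡ = m+[n∸m]≡n {2 * p} (*-cancelˡ-≤ {2 * p} {n} 3 6p≤3n)
  r<p : r < p
  r<p = +-cancelˡ-< (2 * p) r p (subst₂ _<_ (sym n≡) (shuffle p) n<3p)
    where
    shuffle : ∀ p → 3 * p ≡ 2 * p + p
    shuffle = solve-∀
  3≤p : 3 ≤ p
  3≤p = *-cancelˡ-< 3 2 p (≤-<-trans 6≤n n<3p)

-- The finite range and the conclusion

fareyNumerators∤-59-98 : ∀ {n} → n < 99 → 59 ≤ n → ¬ (fareyNumerators n ∣ fareyDenominators n)
fareyNumerators∤-59-98 = from-yes (allUpTo? (λ n → 59 ≤? n →-dec ¬? (fareyNumerators n ∣? fareyDenominators n)) 99)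

isInteger⇒≤58 : ∀ n → IsInteger (F̄ n) → n ≤ 58
isInteger⇒≤58 n integer with n ≤? 58
... | yes n≤58 = n≤58
... | no n≰58 with n <? 99
...   | yes n<99 = contradiction (isInteger⇒∣ n integer) (fareyNumerators∤-59-98 n<99 (≰⇒> n≰58))
...   | no n≮99 with p , w ← ∃-witnessPrime n (≮⇒≥ n≮99) =
  contradiction (isInteger⇒∣ n integer) (witnessPrime⇒farey∤ (≤-trans (≤ᵇ⇒≤ 6 99 _) (≮⇒≥ n≮99)) w)

isInteger? : ∀ n → Dec (IsInteger (F̄ n))
isInteger? n = map′ (∣⇒isInteger n) (isInteger⇒∣ n) (fareyNumerators n ∣? fareyDenominators n)

theorem4p11 : (∃[ ns ] (∀ (n : ℕ) → n ∈ ns ⇔ (1 ≤ n × IsInteger (F̄ n))))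
    × IsInteger (F̄ 58)
    × (∀ (n : ℕ) → 1 ≤ n → IsInteger (F̄ n) → n ≤ 58)
theorem4p11 =
  -- With the bound 58 and decidability at hand, filtering replaces an explicit enumeration.
  (filter good? (upTo 59) , λ n → mk⇔
    (λ n∈ → proj₂ (∈-filter⁻ good? {xs = upTo 59} n∈))
    (λ good → ∈-filter⁺ good? (∈-upTo⁺ (s≤s (isInteger⇒≤58 n (proj₂ good)))) good)) ,
  ∣⇒isInteger 58 (from-yes (fareyNumerators 58 ∣? fareyDenominators 58)) ,
  λ n _ → isInteger⇒≤58 n
  where
  good? : ∀ n → Dec (1 ≤ n × IsInteger (F̄ n))
  good? n = 1 ≤? n ×-dec isInteger? n
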